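{- Let $G$ be a finite group, and pick $H\leq G$. The Schurian scheme of $(G,H)$ is isomorphic to a roux scheme if and only if $(G,H)$ is a Higman pair.
   Context: Association scheme: a sequence of $\{0,1\}$-matrices $A_1=I,A_2,\dots,A_k$ summing to the all-ones matrix whose span is a $*$-algebra under matrix multiplication. Two schemes are isomorphic if conjugating the adjacency matrices of one by some permutation matrix produces the adjacency matrices of the other. Schurian scheme of $(G,H)$: the scheme on $G/H$ with adjacency matrices $A_{HaH}$, one for each double coset, where $(A_{HaH})_{xH,yH}=1$ if $y^{ -1}x\in HaH$ and $0$ otherwise. Higman pair: $H$ is a proper subgroup of the finite group $G$ and, with $K=N_G(H)$ the normalizer of $H$ in $G$, there exists $b\in G\setminus K$ such that: (H1) $G$ acts doubly transitively on $G/K$; (H2) $K/H$ is abelian; (H3) $HbH=Hb^{ -1}H$; (H4) $aba^{ -1}\in HbH$ for every $a\in K$; (H5) $a\in K$ satisfies $ab\in HbH$ only if $a\in H$. Roux: for a finite abelian group $\Gamma$ (identified with its image in the group ring $\mathbb{C}[\Gamma]$), an $n\times n$ matrix $B$ with entries in $\mathbb{C}[\Gamma]$ such that (R1) $B_{ii}=0$ for every $i$; (R2) $B_{ij}\in\Gamma$ for $i\ne j$; (R3) $B_{ji}=(B_{ij})^{ -1}$ for $i\ne j$; (R4) the matrices $\{gI\}_{g\in\Gamma}$ and $\{gB\}_{g\in\Gamma}$ span an algebra. Let $\lceil\cdot\rfloor\colon\mathbb{C}[\Gamma]^{n\times n}\to\mathbb{C}^{n|\Gamma|\times n|\Gamma|}$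 apply the Cayley (regular) representation of $\Gamma$, extended linearly to $\mathbb{C}[\Gamma]$, to each entry; for $x\in\Gamma$, the $(g,h)$ entry of the image of $x$ is $1$ if $xh=g$ and $0$ otherwise. The roux scheme of a roux $B$ for $\Gamma$ is the commutative association scheme with adjacency matrices $\{\lceil gI\rfloor\}_{g\in\Gamma}$ and $\{\lceil gB\rfloor\}_{g\in\Gamma}$. A roux scheme is a scheme that arises in this way from some roux.
   Formalization: The roux is required to have size n ≠ 2, since the claim fails for n = 2: for G = C₂, H = 1, the Schurian scheme is the roux scheme of [[0,1],[1,0]] over the trivial group, yet (C₂,1) is not a Higman pair; 2×2 roux never give Higman pairs. -}

module Defs where

open import Algebra.Bundles using (Group; AbelianGroup; CommutativeMonoid; CommutativeRing)
import Algebra.Consequences.Setoid as Consequences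
open import Algebra.Construct.DirectProduct using (abelianGroup; commutativeMonoid)
import Algebra.Properties.CommutativeMonoid.Sum as Sum
import Algebra.Properties.Group as GroupProperties
import Algebra.Properties.Ring as RingProperties
import Algebra.Solver.Ring.NaturalCoefficients.Default as NaturalCoefficients
open import Data.Bool.Base using (if_then_else_)
open import Data.Fin.Base using (Fin)
import Data.Fin.Properties as Fin
open import Data.Nat.Base as ℕ using (ℕ; _⊔_)
import Data.Nat.Properties as ℕ
open import Data.Product.Base using (Σ; ∃; ∃₂; _×_; _,_; proj₁; proj₂)
open import Data.Product.Relation.Binary.Pointwise.NonDependent using (_×ₛ_)
open import Data.Rational.Base as ℚ using (ℚ; 0ℚ; 1ℚ; ½; ∣_∣)
import Data.Rational.Properties as ℚ
open import Data.Rational.Solver using (module +-*-Solver)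
open import Data.Sum.Base using (_⊎_; inj₁; inj₂)
open import Function.Base using (_∘_)
open import Function.Bundles using (Func; Inverse; mk⇔)
open import Function.Properties.Inverse using (Inverse⇒Injection)
open import Level using (0ℓ)
open import Relation.Binary.Bundles using (Setoid)
open import Relation.Binary.PropositionalEquality as ≡ using (_≡_; _≢_)
import Relation.Binary.Reasoning.Setoid as ≈-Reasoning
open import Relation.Nullary.Decidable using (Dec; does; does-⇔; _×-dec_; map′; via-injection)
open import Relation.Nullary.Negation using (¬_)
open import Relation.Unary using (Pred; Decidable; _≐_)

-- d m n → 0 as m, n → ∞ independently.
Vanishing : (ℕ → ℕ → ℚ) → Set
Vanishing d = ∀ ε → 0ℚ ℚ.< ε → ∃ λ N → ∀ m n → N ℕ.≤ m → N ℕ.≤ n → ∣ d m n ∣ ℚ.< ε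

-- For y = x this is the Cauchy condition, and on Cauchy sequences it says x n - y n → 0.
infix 4 _∼_
record _∼_ (x y : ℕ → ℚ) : Set where
  constructor mk∼
  field
    difference : Vanishing λ m n → x m ℚ.- y n

open _∼_

-- The real numbers are the Cauchy sequences of rationals modulo null sequences; ℂ below
-- is ℝ[i].
record ℝ : Set where
  no-eta-equality
  constructor mkℝ
  field
    seq    : ℕ → ℚ
    cauchy : seq ∼ seq

open ℝ

infix 4 _≈ᴿ_
record _≈ᴿ_ (x y : ℝ) : Set where
  constructor mk≈
  field
    seq-∼ : seq x ∼ seq y

open _≈ᴿ_

bounded : ∀ {x y} → x ∼ y → ∃ λ b → 0ℚ ℚ.< b × ∃ λ N → ∀ n → N ℕ.≤ n → ∣ x n ∣ ℚ.≤ b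
bounded {x} {y} x∼y with difference x∼y 1ℚ (ℚ.positive⁻¹ 1ℚ)
... | N , close =
  1ℚ ℚ.+ ∣ y N ∣
  , ℚ.+-mono-<-≤ (ℚ.positive⁻¹ 1ℚ) (ℚ.0≤∣p∣ (y N))
  , N
  , λ n N≤n → begin
      ∣ x n ∣                        ≡⟨ ≡.cong ∣_∣ (solve 2 (λ a b → a := (a :- b) :+ b) ≡.refl (x n) (y N)) ⟩
      ∣ (x n ℚ.- y N) ℚ.+ y N ∣      ≤⟨ ℚ.∣p+q∣≤∣p∣+∣q∣ (x n ℚ.- y N) (y N) ⟩
      ∣ x n ℚ.- y N ∣ ℚ.+ ∣ y N ∣    ≤⟨ ℚ.+-monoˡ-≤ ∣ y N ∣ (ℚ.<⇒≤ (close n N N≤n ℕ.≤-refl)) ⟩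
      1ℚ ℚ.+ ∣ y N ∣                 ∎
  where open ℚ.≤-Reasoning
        open +-*-Solver

vanishing-cong : ∀ {d e} → (∀ m n → d m n ≡ e m n) → Vanishing d → Vanishing e
vanishing-cong d≗e d→0 ε 0<ε with d→0 ε 0<ε
... | N , small = N , λ m n N≤m N≤n → ≡.subst (λ q → ∣ q ∣ ℚ.< ε) (d≗e m n) (small m n N≤m N≤n)

vanishing-swap : ∀ {d} → Vanishing d → Vanishing (λ m n → d n m)
vanishing-swap d→0 ε 0<ε with d→0 ε 0<ε
... | N , small = N , λ m n N≤m N≤n → small n m N≤n N≤m

vanishing-neg : ∀ {d} → Vanishing d → Vanishing (λ m n → ℚ.- d m n)
vanishing-neg {d} d→0 ε 0<ε with d→0 ε 0<ε
... | N , small = N , λ m n N≤m N≤n →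
  ≡.subst (ℚ._< ε) (≡.sym (ℚ.∣-p∣≡∣p∣ (d m n))) (small m n N≤m N≤n)

vanishing-+ : ∀ {d e} → Vanishing d → Vanishing e → Vanishing (λ m n → d m n ℚ.+ e m n)
vanishing-+ {d} {e} d→0 e→0 ε 0<ε
  with d→0 (½ ℚ.* ε) 0<½ε | e→0 (½ ℚ.* ε) 0<½ε
  where 0<½ε : 0ℚ ℚ.< ½ ℚ.* ε
        0<½ε = ≡.subst (ℚ._< ½ ℚ.* ε) (ℚ.*-zeroʳ ½) (ℚ.*-monoʳ-<-pos ½ 0<ε)
... | N₁ , small₁ | N₂ , small₂ = N₁ ⊔ N₂ , λ m n N≤m N≤n → begin-strict
  ∣ d m n ℚ.+ e m n ∣        ≤⟨ ℚ.∣p+q∣≤∣p∣+∣q∣ (d m n) (e m n) ⟩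
  ∣ d m n ∣ ℚ.+ ∣ e m n ∣    <⟨ ℚ.+-mono-<
                                  (small₁ m n (ℕ.m⊔n≤o⇒m≤o N₁ N₂ N≤m) (ℕ.m⊔n≤o⇒m≤o N₁ N₂ N≤n))
                                  (small₂ m n (ℕ.m⊔n≤o⇒n≤o N₁ N₂ N≤m) (ℕ.m⊔n≤o⇒n≤o N₁ N₂ N≤n)) ⟩
  ½ ℚ.* ε ℚ.+ ½ ℚ.* ε        ≡⟨ ℚ.*-distribʳ-+ ε ½ ½ ⟨
  1ℚ ℚ.* ε                   ≡⟨ ℚ.*-identityˡ ε ⟩
  ε                          ∎
  where open ℚ.≤-Reasoning

vanishing-* : ∀ (c d : ℕ → ℕ → ℚ) b N → 0ℚ ℚ.< b → (∀ m n → N ℕ.≤ m → N ℕ.≤ n → ∣ c m n ∣ ℚ.≤ b) →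
              Vanishing d → Vanishing (λ m n → c m n ℚ.* d m n)
vanishing-* c d b N₁ 0<b bound d→0 ε 0<ε
  with d→0 (b⁻¹ ℚ.* ε) 0<b⁻¹ε
  where
  instance
    b-positive   = ℚ.positive 0<b
    b-nonZero    = ℚ.pos⇒nonZero b
    b⁻¹-positive = ℚ.1/pos⇒pos b
  b⁻¹ = ℚ.1/ b
  0<b⁻¹ε : 0ℚ ℚ.< b⁻¹ ℚ.* ε
  0<b⁻¹ε = ≡.subst (ℚ._< b⁻¹ ℚ.* ε) (ℚ.*-zeroʳ b⁻¹) (ℚ.*-monoʳ-<-pos b⁻¹ 0<ε)
... | N₂ , small = N₁ ⊔ N₂ , λ m n N≤m N≤n → begin-strict
  ∣ c m n ℚ.* d m n ∣        ≡⟨ ℚ.∣p*q∣≡∣p∣*∣q∣ (c m n) (d m n) ⟩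
  ∣ c m n ∣ ℚ.* ∣ d m n ∣    ≤⟨ ℚ.*-monoʳ-≤-nonNeg ∣ d m n ∣ {{ℚ.nonNegative (ℚ.0≤∣p∣ (d m n))}}
                                  (bound m n (ℕ.m⊔n≤o⇒m≤o N₁ N₂ N≤m) (ℕ.m⊔n≤o⇒m≤o N₁ N₂ N≤n)) ⟩
  b ℚ.* ∣ d m n ∣            <⟨ ℚ.*-monoʳ-<-pos b
                                  (small m n (ℕ.m⊔n≤o⇒n≤o N₁ N₂ N≤m) (ℕ.m⊔n≤o⇒n≤o N₁ N₂ N≤n)) ⟩
  b ℚ.* (ℚ.1/ b ℚ.* ε)       ≡⟨ ℚ.*-assoc b (ℚ.1/ b) ε ⟨
  (b ℚ.* ℚ.1/ b) ℚ.* ε       ≡⟨ ≡.cong (ℚ._* ε) (ℚ.*-inverseʳ b) ⟩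
  1ℚ ℚ.* ε                   ≡⟨ ℚ.*-identityˡ ε ⟩
  ε                          ∎
  where
  open ℚ.≤-Reasoning
  instance
    b-positive = ℚ.positive 0<b
    b-nonZero  = ℚ.pos⇒nonZero b

constant-∼ : ∀ q → (λ _ → q) ∼ (λ _ → q)
difference (constant-∼ q) ε 0<ε = 0 , λ _ _ _ _ → ≡.subst (λ p → ∣ p ∣ ℚ.< ε) (≡.sym (ℚ.+-inverseʳ q)) 0<ε

∼-sym : ∀ {x y} → x ∼ y → y ∼ x
∼-sym {x} {y} x∼y .difference = vanishing-cong
  (λ m n → solve 2 (λ a b → :- (a :- b) := b :- a) ≡.refl (x n) (y m))
  (vanishing-neg (vanishing-swap (difference x∼y)))
  where open +-*-Solver

∼-trans : ∀ {x y z} → x ∼ y → y ∼ z → x ∼ z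
∼-trans {x} {y} {z} x∼y y∼z .difference = vanishing-cong
  (λ m n → solve 3 (λ a b c → (a :- b) :+ (b :- c) := a :- c) ≡.refl (x m) (y m) (z n))
  (vanishing-+ {λ m n → x m ℚ.- y m} (diagonal (difference x∼y)) (difference y∼z))
  where
  open +-*-Solver
  diagonal : ∀ {d} → Vanishing d → Vanishing (λ m _ → d m m)
  diagonal d→0 ε 0<ε with d→0 ε 0<ε
  ... | N , small = N , λ m _ N≤m _ → small m m N≤m N≤m

neg-∼ : ∀ {x y} → x ∼ y → (λ n → ℚ.- x n) ∼ (λ n → ℚ.- y n)
neg-∼ {x} {y} x∼y .difference = vanishing-cong
  (λ m n → solve 2 (λ a b → :- (a :- b) := :- a :- :- b) ≡.refl (x m) (y n))
  (vanishing-neg (difference x∼y))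
  where open +-*-Solver

+-∼ : ∀ {x y u v} → x ∼ y → u ∼ v → (λ n → x n ℚ.+ u n) ∼ (λ n → y n ℚ.+ v n)
+-∼ {x} {y} {u} {v} x∼y u∼v .difference = vanishing-cong
  (λ m n → solve 4 (λ a b c d → (a :- b) :+ (c :- d) := (a :+ c) :- (b :+ d)) ≡.refl (x m) (y n) (u m) (v n))
  (vanishing-+ (difference x∼y) (difference u∼v))
  where open +-*-Solver

*-∼ : ∀ {x y u v} → x ∼ y → u ∼ v → (λ n → x n ℚ.* u n) ∼ (λ n → y n ℚ.* v n)
*-∼ {x} {y} {u} {v} x∼y u∼v = combine (bounded x∼y) (bounded (∼-sym u∼v))
  where
  open +-*-Solver
  combine : (∃ λ b → 0ℚ ℚ.< b × ∃ λ N → ∀ n → N ℕ.≤ n → ∣ x n ∣ ℚ.≤ b) →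
            (∃ λ b → 0ℚ ℚ.< b × ∃ λ N → ∀ n → N ℕ.≤ n → ∣ v n ∣ ℚ.≤ b) →
            (λ n → x n ℚ.* u n) ∼ (λ n → y n ℚ.* v n)
  combine (b , 0<b , M , ∣x∣≤b) (c , 0<c , N , ∣v∣≤c) .difference = vanishing-cong
    (λ m n → solve 4 (λ a b c d → a :* (c :- d) :+ d :* (a :- b) := a :* c :- b :* d) ≡.refl (x m) (y n) (u m) (v n))
    (vanishing-+
      (vanishing-* (λ m _ → x m) (λ m n → u m ℚ.- v n) b M 0<b (λ m _ M≤m _ → ∣x∣≤b m M≤m) (difference u∼v))
      (vanishing-* (λ _ n → v n) (λ m n → x m ℚ.- y n) c N 0<c (λ _ n _ N≤n → ∣v∣≤c n N≤n) (difference x∼y)))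

pointwise : ∀ {x y} → (∀ n → seq x n ≡ seq y n) → x ≈ᴿ y
pointwise {x} x≗y .seq-∼ .difference =
  vanishing-cong (λ m n → ≡.cong (λ q → seq x m ℚ.- q) (x≗y n)) (difference (cauchy x))

≈ᴿ-refl : ∀ {x} → x ≈ᴿ x
≈ᴿ-refl {x} = mk≈ (cauchy x)

≈ᴿ-sym : ∀ {x y} → x ≈ᴿ y → y ≈ᴿ x
≈ᴿ-sym (mk≈ p) = mk≈ (∼-sym p)

≈ᴿ-trans : ∀ {x y z} → x ≈ᴿ y → y ≈ᴿ z → x ≈ᴿ z
≈ᴿ-trans (mk≈ p) (mk≈ q) = mk≈ (∼-trans p q)

infixl 6 _+ᴿ_
infixl 7 _*ᴿ_
infix  8 -ᴿ_

-- Opaque, as conversion checking would otherwise unfold rational arithmetic.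
opaque
  fromℚ : ℚ → ℝ
  fromℚ q = mkℝ (λ _ → q) (constant-∼ q)

  _+ᴿ_ _*ᴿ_ : ℝ → ℝ → ℝ
  x +ᴿ y = mkℝ (λ n → seq x n ℚ.+ seq y n) (+-∼ (cauchy x) (cauchy y))
  x *ᴿ y = mkℝ (λ n → seq x n ℚ.* seq y n) (*-∼ (cauchy x) (cauchy y))

  -ᴿ_ : ℝ → ℝ
  -ᴿ x = mkℝ (λ n → ℚ.- seq x n) (neg-∼ (cauchy x))

  -ᴿ-cong : ∀ {x y} → x ≈ᴿ y → -ᴿ x ≈ᴿ -ᴿ y
  -ᴿ-cong (mk≈ p) = mk≈ (neg-∼ p)

  +ᴿ-cong : ∀ {x y u v} → x ≈ᴿ y → u ≈ᴿ v → x +ᴿ u ≈ᴿ y +ᴿ v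
  +ᴿ-cong (mk≈ p) (mk≈ q) = mk≈ (+-∼ p q)

  *ᴿ-cong : ∀ {x y u v} → x ≈ᴿ y → u ≈ᴿ v → x *ᴿ u ≈ᴿ y *ᴿ v
  *ᴿ-cong (mk≈ p) (mk≈ q) = mk≈ (*-∼ p q)

  +ᴿ-assoc : ∀ x y z → (x +ᴿ y) +ᴿ z ≈ᴿ x +ᴿ (y +ᴿ z)
  +ᴿ-assoc x y z = pointwise λ n → ℚ.+-assoc (seq x n) (seq y n) (seq z n)

  +ᴿ-comm : ∀ x y → x +ᴿ y ≈ᴿ y +ᴿ x
  +ᴿ-comm x y = pointwise λ n → ℚ.+-comm (seq x n) (seq y n)

  +ᴿ-identityˡ : ∀ x → fromℚ 0ℚ +ᴿ x ≈ᴿ x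
  +ᴿ-identityˡ x = pointwise λ n → ℚ.+-identityˡ (seq x n)

  +ᴿ-inverseˡ : ∀ x → -ᴿ x +ᴿ x ≈ᴿ fromℚ 0ℚ
  +ᴿ-inverseˡ x = pointwise λ n → ℚ.+-inverseˡ (seq x n)

  *ᴿ-assoc : ∀ x y z → (x *ᴿ y) *ᴿ z ≈ᴿ x *ᴿ (y *ᴿ z)
  *ᴿ-assoc x y z = pointwise λ n → ℚ.*-assoc (seq x n) (seq y n) (seq z n)

  *ᴿ-comm : ∀ x y → x *ᴿ y ≈ᴿ y *ᴿ x
  *ᴿ-comm x y = pointwise λ n → ℚ.*-comm (seq x n) (seq y n)

  *ᴿ-identityˡ : ∀ x → fromℚ 1ℚ *ᴿ x ≈ᴿ x
  *ᴿ-identityˡ x = pointwise λ n → ℚ.*-identityˡ (seq x n)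

  *ᴿ-distribˡ-+ᴿ : ∀ x y z → x *ᴿ (y +ᴿ z) ≈ᴿ x *ᴿ y +ᴿ x *ᴿ z
  *ᴿ-distribˡ-+ᴿ x y z = pointwise λ n → ℚ.*-distribˡ-+ (seq x n) (seq y n) (seq z n)

ℝ-setoid : Setoid 0ℓ 0ℓ
ℝ-setoid = record
  { Carrier = ℝ
  ; _≈_ = _≈ᴿ_
  ; isEquivalence = record { refl = ≈ᴿ-refl ; sym = ≈ᴿ-sym ; trans = ≈ᴿ-trans }
  }

ℝ-ring : CommutativeRing 0ℓ 0ℓ
ℝ-ring = record
  { Carrier = ℝ
  ; _≈_ = _≈ᴿ_
  ; _+_ = _+ᴿ_
  ; _*_ = _*ᴿ_
  ; -_  = -ᴿ_
  ; 0#  = fromℚ 0ℚ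
  ; 1#  = fromℚ 1ℚ
  ; isCommutativeRing = record
    { isRing = record
      { +-isAbelianGroup = record
        { isGroup = record
          { isMonoid = record
            { isSemigroup = record
              { isMagma = record { isEquivalence = Setoid.isEquivalence ℝ-setoid ; ∙-cong = +ᴿ-cong }
              ; assoc = +ᴿ-assoc
              }
            ; identity = comm∧idˡ⇒id +ᴿ-comm +ᴿ-identityˡ
            }
          ; inverse = comm∧invˡ⇒inv +ᴿ-comm +ᴿ-inverseˡ
          ; ⁻¹-cong = -ᴿ-cong
          }
        ; comm = +ᴿ-comm
        }
      ; *-cong = *ᴿ-cong
      ; *-assoc = *ᴿ-assoc
      ; *-identity = comm∧idˡ⇒id *ᴿ-comm *ᴿ-identityˡ
      ; distrib = comm∧distrˡ⇒distr +ᴿ-cong *ᴿ-comm *ᴿ-distribˡ-+ᴿ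
      }
    ; *-comm = *ᴿ-comm
    }
  }
  where open Consequences ℝ-setoid using (comm∧idˡ⇒id; comm∧invˡ⇒inv; comm∧distrˡ⇒distr)

-- R[X] / (X² + 1), with (a , b) standing for a + b i.
module Complexification (R : CommutativeRing 0ℓ 0ℓ) where
  open CommutativeRing R
  open RingProperties ring using (-‿distribˡ-*; -‿distribʳ-*; -‿+-comm; -0#≈0#)
  open NaturalCoefficients commutativeSemiring
  open ≈-Reasoning setoid

  infix  4 _≈ᶜ_
  infixl 6 _+ᶜ_
  infixl 7 _*ᶜ_

  _≈ᶜ_ : Carrier × Carrier → Carrier × Carrier → Set
  (a , b) ≈ᶜ (c , d) = a ≈ c × b ≈ d

  _+ᶜ_ _*ᶜ_ : Carrier × Carrier → Carrier × Carrier → Carrier × Carrier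
  (a , b) +ᶜ (c , d) = a + c , b + d
  (a , b) *ᶜ (c , d) = a * c - b * d , a * d + b * c

  *ᶜ-assoc : ∀ x y z → (x *ᶜ y) *ᶜ z ≈ᶜ x *ᶜ (y *ᶜ z)
  *ᶜ-assoc (a , b) (c , d) (e , f) = real , imaginary
    where
    real : (a * c - b * d) * e - (a * d + b * c) * f ≈ a * (c * e - d * f) - b * (c * f + d * e)
    real = begin
      (a * c - b * d) * e - (a * d + b * c) * f
        ≈⟨ +-cong (*-congʳ (+-congˡ (-‿distribʳ-* b d))) (-‿distribʳ-* (a * d + b * c) f) ⟩
      (a * c + b * - d) * e + (a * d + b * c) * - f
        ≈⟨ solve 8 (λ a b c d e f d⁻ f⁻ →
             (a :* c :+ b :* d⁻) :* e :+ (a :* d :+ b :* c) :* f⁻ :=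
             a :* (c :* e :+ d :* f⁻) :+ b :* (c :* f⁻ :+ d⁻ :* e)) refl a b c d e f (- d) (- f) ⟩
      a * (c * e + d * - f) + b * (c * - f + - d * e)
        ≈⟨ +-cong (*-congˡ (+-congˡ (-‿distribʳ-* d f)))
                  (*-congˡ (+-cong (-‿distribʳ-* c f) (-‿distribˡ-* d e))) ⟨
      a * (c * e - d * f) + b * (- (c * f) - d * e)
        ≈⟨ +-congˡ (trans (*-congˡ (-‿+-comm (c * f) (d * e))) (sym (-‿distribʳ-* b (c * f + d * e)))) ⟩
      a * (c * e - d * f) - b * (c * f + d * e) ∎

    imaginary : (a * c - b * d) * f + (a * d + b * c) * e ≈ a * (c * f + d * e) + b * (c * e - d * f)
    imaginary = begin
      (a * c - b * d) * f + (a * d + b * c) * e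
        ≈⟨ +-congʳ (*-congʳ (+-congˡ (-‿distribʳ-* b d))) ⟩
      (a * c + b * - d) * f + (a * d + b * c) * e
        ≈⟨ solve 7 (λ a b c d e f d⁻ →
             (a :* c :+ b :* d⁻) :* f :+ (a :* d :+ b :* c) :* e :=
             a :* (c :* f :+ d :* e) :+ b :* (c :* e :+ d⁻ :* f)) refl a b c d e f (- d) ⟩
      a * (c * f + d * e) + b * (c * e + - d * f)
        ≈⟨ +-congˡ (*-congˡ (+-congˡ (-‿distribˡ-* d f))) ⟨
      a * (c * f + d * e) + b * (c * e - d * f) ∎

  *ᶜ-comm : ∀ x y → x *ᶜ y ≈ᶜ y *ᶜ x
  *ᶜ-comm (a , b) (c , d) =
    +-cong (*-comm a c) (-‿cong (*-comm b d)) ,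
    solve 4 (λ a b c d → a :* d :+ b :* c := c :* b :+ d :* a) refl a b c d

  *ᶜ-identityˡ : ∀ x → (1# , 0#) *ᶜ x ≈ᶜ x
  *ᶜ-identityˡ (a , b) =
    trans (+-cong (*-identityˡ a) (trans (-‿cong (zeroˡ b)) -0#≈0#)) (+-identityʳ a) ,
    trans (+-cong (*-identityˡ b) (zeroˡ a)) (+-identityʳ b)

  *ᶜ-distribˡ-+ᶜ : ∀ x y z → x *ᶜ (y +ᶜ z) ≈ᶜ x *ᶜ y +ᶜ x *ᶜ z
  *ᶜ-distribˡ-+ᶜ (a , b) (c , d) (e , f) = real , imaginary
    where
    real : a * (c + e) - b * (d + f) ≈ (a * c - b * d) + (a * e - b * f)
    real = begin
      a * (c + e) - b * (d + f)
        ≈⟨ +-congˡ (-‿distribˡ-* b (d + f)) ⟩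
      a * (c + e) + - b * (d + f)
        ≈⟨ solve 6 (λ a b⁻ c d e f →
             a :* (c :+ e) :+ b⁻ :* (d :+ f) := (a :* c :+ b⁻ :* d) :+ (a :* e :+ b⁻ :* f)) refl a (- b) c d e f ⟩
      (a * c + - b * d) + (a * e + - b * f)
        ≈⟨ +-cong (+-congˡ (-‿distribˡ-* b d)) (+-congˡ (-‿distribˡ-* b f)) ⟨
      (a * c - b * d) + (a * e - b * f) ∎

    imaginary : a * (d + f) + b * (c + e) ≈ (a * d + b * c) + (a * f + b * e)
    imaginary = solve 6 (λ a b c d e f →
      a :* (d :+ f) :+ b :* (c :+ e) := (a :* d :+ b :* c) :+ (a :* f :+ b :* e)) refl a b c d e f

  complexification : CommutativeRing 0ℓ 0ℓ
  complexification = record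
    { Carrier = Carrier × Carrier
    ; _≈_ = _≈ᶜ_
    ; _+_ = _+ᶜ_
    ; _*_ = _*ᶜ_
    ; -_  = λ (a , b) → - a , - b
    ; 0#  = 0# , 0#
    ; 1#  = 1# , 0#
    ; isCommutativeRing = record
      { isRing = record
        { +-isAbelianGroup = AbelianGroup.isAbelianGroup (abelianGroup +-abelianGroup +-abelianGroup)
        ; *-cong = *ᶜ-cong
        ; *-assoc = *ᶜ-assoc
        ; *-identity = comm∧idˡ⇒id *ᶜ-comm *ᶜ-identityˡ
        ; distrib = comm∧distrˡ⇒distr (CommutativeMonoid.∙-cong +ᶜ-monoid) *ᶜ-comm *ᶜ-distribˡ-+ᶜ
        }
      ; *-comm = *ᶜ-comm
      }
    }
    where
    +ᶜ-monoid = commutativeMonoid +-commutativeMonoid +-commutativeMonoid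
    open Consequences (CommutativeMonoid.setoid +ᶜ-monoid) using (comm∧idˡ⇒id; comm∧distrˡ⇒distr)
    *ᶜ-cong : ∀ {x y u v} → x ≈ᶜ y → u ≈ᶜ v → x *ᶜ u ≈ᶜ y *ᶜ v
    *ᶜ-cong (p , q) (r , s) = +-cong (*-cong p r) (-‿cong (*-cong q s)) , +-cong (*-cong p s) (*-cong q r)

opaque
  ℂ : CommutativeRing 0ℓ 0ℓ
  ℂ = Complexification.complexification ℝ-ring

module ℂ = CommutativeRing ℂ

opaque
  unfolding ℂ fromℚ

  1≉0 : ¬ (ℂ.1# ℂ.≈ ℂ.0#)
  1≉0 (mk≈ 1∼0 , _) with difference 1∼0 1ℚ (ℚ.positive⁻¹ 1ℚ)
  ... | N , close = ℚ.<-irrefl ≡.refl (close N N ℕ.≤-refl ℕ.≤-refl)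

indicator : {A : Set} → Dec A → ℂ.Carrier
indicator a? = if does a? then ℂ.1# else ℂ.0#

indicator-cong : {A B : Set} → (A → B) → (B → A) → (a? : Dec A) (b? : Dec B) → indicator a? ℂ.≈ indicator b?
indicator-cong to from a? b? =
  ℂ.reflexive (≡.cong (λ b → if b then ℂ.1# else ℂ.0#) (does-⇔ (mk⇔ to from) a? b?))

Finite : Setoid 0ℓ 0ℓ → Set
Finite S = ∃ λ n → Inverse S (≡.setoid (Fin n))

module Finiteness {S : Setoid 0ℓ 0ℓ} (finite : Finite S) where
  open Setoid S

  enumerate : Fin (proj₁ finite) → Carrier
  enumerate = Inverse.from (proj₂ finite)

  infix 4 _≟_
  _≟_ : (x y : Carrier) → Dec (x ≈ y)
  _≟_ = via-injection (Inverse⇒Injection (proj₂ finite)) Fin._≟_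

-- Complex matrices with rows and columns indexed by the elements of X.
SquareMatrix : Setoid 0ℓ 0ℓ → Set
SquareMatrix X = Func (X ×ₛ X) ℂ.setoid

-- The data of an association scheme: its adjacency matrices.  The axioms of a scheme play
-- no part in the notion of isomorphism.  Index may list a matrix more than once.
record MatrixFamily : Set₁ where
  field
    points    : Setoid 0ℓ 0ℓ
    Index     : Set
    adjacency : Index → SquareMatrix points

-- Conjugation by the permutation matrix of a bijection σ carries the (x , y) entry to
-- the (σ x , σ y) entry.  Since the adjacency matrices are not given in a preferred
-- order, the two families are compared as sets of matrices.
record _≅_ (S T : MatrixFamily) : Set where
  open MatrixFamily
  field
    bijection : Inverse (points S) (points T)

  _↦_ : SquareMatrix (points S) → SquareMatrix (points T) → Set
  A ↦ B = ∀ x y → Func.to A (x , y) ℂ.≈ Func.to B (Inverse.to bijection x , Inverse.to bijection y)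

  field
    onto-⊆ : ∀ i → ∃ λ j → adjacency S i ↦ adjacency T j
    onto-⊇ : ∀ j → ∃ λ i → adjacency S i ↦ adjacency T j

record Subgroup (G : Group 0ℓ 0ℓ) : Set₁ where
  open Group G
  field
    Member    : Pred Carrier 0ℓ
    respects  : ∀ {x y} → x ≈ y → Member x → Member y
    ε-closed  : Member ε
    ∙-closed  : ∀ {x y} → Member x → Member y → Member (x ∙ y)
    ⁻¹-closed : ∀ {x} → Member x → Member (x ⁻¹)

module _ {G : Group 0ℓ 0ℓ} (H : Subgroup G) where
  open Group G renaming (refl to ≈-refl; sym to ≈-sym; trans to ≈-trans)
  open GroupProperties G
  open Subgroup H
  open ≈-Reasoning setoid

  leftCosets : Setoid 0ℓ 0ℓ
  leftCosets = record
    { Carrier = Carrier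
    ; _≈_ = λ x y → Member (x ⁻¹ ∙ y)
    ; isEquivalence = record
      { refl  = λ {x} → respects (≈-sym (inverseˡ x)) ε-closed
      ; sym   = λ {x} {y} p → respects (⁻¹-anti-homo-\\ x y) (⁻¹-closed p)
      ; trans = λ {x} {y} {z} p q → respects (cancel x y z) (∙-closed p q)
      }
    }
    where
    cancel : ∀ x y z → (x ⁻¹ ∙ y) ∙ (y ⁻¹ ∙ z) ≈ x ⁻¹ ∙ z
    cancel x y z = ≈-trans (assoc (x ⁻¹) y (y ⁻¹ ∙ z)) (∙-congˡ (\\-leftDividesˡ y z))

  doubleCoset : Carrier → Pred Carrier 0ℓ
  doubleCoset a x = ∃₂ λ h k → Member h × Member k × x ≈ h ∙ a ∙ k

  conjugate : Carrier → Pred Carrier 0ℓ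
  conjugate g x = ∃ λ h → Member h × x ≈ g ∙ h ∙ g ⁻¹

  private
    conjugate-cong : ∀ {g g′ h h′} → g ≈ g′ → h ≈ h′ → g ∙ h ∙ g ⁻¹ ≈ g′ ∙ h′ ∙ g′ ⁻¹
    conjugate-cong p q = ∙-cong (∙-cong p q) (⁻¹-cong p)

    conjugate-ε : ∀ h → ε ∙ h ∙ ε ⁻¹ ≈ h
    conjugate-ε h = ≈-trans (∙-cong (identityˡ h) ε⁻¹≈ε) (identityʳ h)

    conjugate-∙ : ∀ g g′ h → (g ∙ g′) ∙ h ∙ (g ∙ g′) ⁻¹ ≈ g ∙ (g′ ∙ h ∙ g′ ⁻¹) ∙ g ⁻¹
    conjugate-∙ g g′ h = begin
      (g ∙ g′) ∙ h ∙ (g ∙ g′) ⁻¹        ≈⟨ ∙-cong (assoc g g′ h) (⁻¹-anti-homo-∙ g g′) ⟩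
      g ∙ (g′ ∙ h) ∙ (g′ ⁻¹ ∙ g ⁻¹)     ≈⟨ assoc (g ∙ (g′ ∙ h)) (g′ ⁻¹) (g ⁻¹) ⟨
      g ∙ (g′ ∙ h) ∙ g′ ⁻¹ ∙ g ⁻¹       ≈⟨ ∙-congʳ (assoc g (g′ ∙ h) (g′ ⁻¹)) ⟩
      g ∙ (g′ ∙ h ∙ g′ ⁻¹) ∙ g ⁻¹       ∎

    conjugate-⁻¹ : ∀ g h → g ⁻¹ ∙ (g ∙ h ∙ g ⁻¹) ∙ (g ⁻¹) ⁻¹ ≈ h
    conjugate-⁻¹ g h = begin
      g ⁻¹ ∙ (g ∙ h ∙ g ⁻¹) ∙ (g ⁻¹) ⁻¹   ≈⟨ conjugate-∙ (g ⁻¹) g h ⟨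
      (g ⁻¹ ∙ g) ∙ h ∙ (g ⁻¹ ∙ g) ⁻¹      ≈⟨ conjugate-cong (inverseˡ g) ≈-refl ⟩
      ε ∙ h ∙ ε ⁻¹                        ≈⟨ conjugate-ε h ⟩
      h                                   ∎

  normalizer : Subgroup G
  normalizer = record
    { Member    = λ g → conjugate g ≐ Member
    ; respects  = λ p (gHg⁻¹⊆H , H⊆gHg⁻¹) →
        (λ (h , h∈H , x≈) → gHg⁻¹⊆H (h , h∈H , ≈-trans x≈ (conjugate-cong (≈-sym p) ≈-refl))) ,
        (λ x∈H → let h , h∈H , x≈ = H⊆gHg⁻¹ x∈H in h , h∈H , ≈-trans x≈ (conjugate-cong p ≈-refl))
    ; ε-closed  =
        (λ (h , h∈H , x≈) → respects (≈-sym (≈-trans x≈ (conjugate-ε h))) h∈H) ,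
        (λ {x} x∈H → x , x∈H , ≈-sym (conjugate-ε x))
    ; ∙-closed  = λ {g} {g′} (g⊆ , g⊇) (g′⊆ , g′⊇) →
        (λ (h , h∈H , x≈) → g⊆ (_ , g′⊆ (h , h∈H , ≈-refl) , ≈-trans x≈ (conjugate-∙ g g′ h))) ,
        (λ x∈H → let h , h∈H , x≈ = g⊇ x∈H ; k , k∈H , h≈ = g′⊇ h∈H in
          k , k∈H , ≈-trans x≈ (≈-trans (conjugate-cong ≈-refl h≈) (≈-sym (conjugate-∙ g g′ k))))
    ; ⁻¹-closed = λ {g} (g⊆ , g⊇) →
        (λ (h , h∈H , x≈) → let k , k∈H , h≈ = g⊇ h∈H in
          respects (≈-sym (≈-trans x≈ (≈-trans (conjugate-cong ≈-refl h≈) (conjugate-⁻¹ g k)))) k∈H) ,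
        (λ {x} x∈H → _ , g⊆ (x , x∈H , ≈-refl) , ≈-sym (conjugate-⁻¹ g x))
    }

DoublyTransitive : (G : Group 0ℓ 0ℓ) (X : Setoid 0ℓ 0ℓ) → (Group.Carrier G → Setoid.Carrier X → Setoid.Carrier X) → Set
DoublyTransitive G X _·_ =
  ∀ x x′ y y′ → ¬ (x ≈ x′) → ¬ (y ≈ y′) → ∃ λ g → (g · x) ≈ y × (g · x′) ≈ y′
  where open Setoid X

record HigmanPair (G : Group 0ℓ 0ℓ) (H : Subgroup G) : Set where
  open Group G
  open Subgroup H using () renaming (Member to _∈H)
  open Subgroup (normalizer H) using () renaming (Member to _∈K)
  open Setoid (leftCosets H) using () renaming (_≈_ to _≈ᴴ_)
  field
    proper : ∃ λ g → ¬ g ∈H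
    b      : Carrier
    b∉K    : ¬ b ∈K
    H1     : DoublyTransitive G (leftCosets (normalizer H)) _∙_
    H2     : ∀ {x y} → x ∈K → y ∈K → (x ∙ y) ≈ᴴ (y ∙ x)
    H3     : doubleCoset H b ≐ doubleCoset H (b ⁻¹)
    H4     : ∀ {a} → a ∈K → doubleCoset H b (a ∙ b ∙ a ⁻¹)
    H5     : ∀ {a} → a ∈K → doubleCoset H b (a ∙ b) → a ∈H

module _ (G : Group 0ℓ 0ℓ) (finite : Finite (Group.setoid G))
         (H : Subgroup G) (_∈H? : Decidable (Subgroup.Member H)) where
  open Group G renaming (sym to ≈-sym; trans to ≈-trans)
  open GroupProperties G
  open Subgroup H
  open Finiteness finite

  doubleCoset? : ∀ a x → Dec (doubleCoset H a x)
  doubleCoset? a x = map′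
    (λ (i , j , h∈H , k∈H , x≈) → enumerate i , enumerate j , h∈H , k∈H , x≈)
    (λ (h , k , h∈H , k∈H , x≈) → index h , index k , respects (≈-sym (enumerate-index h)) h∈H
                                , respects (≈-sym (enumerate-index k)) k∈H
                                , ≈-trans x≈ (≈-sym (∙-cong (∙-congʳ (enumerate-index h)) (enumerate-index k))))
    (Fin.any? λ i → Fin.any? λ j →
      (enumerate i ∈H?) ×-dec (enumerate j ∈H?) ×-dec (x ≟ enumerate i ∙ a ∙ enumerate j))
    where
    index : Carrier → Fin (proj₁ finite)
    index = Inverse.to (proj₂ finite)
    enumerate-index : ∀ x → enumerate (index x) ≈ x
    enumerate-index x = Inverse.strictlyInverseʳ (proj₂ finite) x

  schurianScheme : MatrixFamily
  schurianScheme = record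
    { points    = leftCosets H
    ; Index     = Carrier
    ; adjacency = λ a → record
      { to   = λ (x , y) → indicator (doubleCoset? a (y ⁻¹ ∙ x))
      ; cong = λ {(x , y)} {(x′ , y′)} (x∼x′ , y∼y′) →
          indicator-cong (translate x∼x′ y∼y′) (translate (~.sym {x} {x′} x∼x′) (~.sym {y} {y′} y∼y′))
            (doubleCoset? a (y ⁻¹ ∙ x)) (doubleCoset? a (y′ ⁻¹ ∙ x′))
      }
    }
    where
    module ~ = Setoid (leftCosets H)
    open ≈-Reasoning setoid
    translate : ∀ {a x x′ y y′} → x ~.≈ x′ → y ~.≈ y′ →
                doubleCoset H a (y ⁻¹ ∙ x) → doubleCoset H a (y′ ⁻¹ ∙ x′)
    translate {a} {x} {x′} {y} {y′} x∼x′ y∼y′ (h , k , h∈H , k∈H , y⁻¹x≈hak) =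
      (y′ ⁻¹ ∙ y) ∙ h , k ∙ (x ⁻¹ ∙ x′) ,
      ∙-closed (~.sym {y} {y′} y∼y′) h∈H , ∙-closed k∈H x∼x′ , (begin
        y′ ⁻¹ ∙ x′                                     ≈⟨ ∙-congˡ (\\-leftDividesˡ y x′) ⟨
        y′ ⁻¹ ∙ (y ∙ (y ⁻¹ ∙ x′))                      ≈⟨ assoc (y′ ⁻¹) y (y ⁻¹ ∙ x′) ⟨
        (y′ ⁻¹ ∙ y) ∙ (y ⁻¹ ∙ x′)                      ≈⟨ ∙-congˡ (∙-congˡ (\\-leftDividesˡ x x′)) ⟨
        (y′ ⁻¹ ∙ y) ∙ (y ⁻¹ ∙ (x ∙ (x ⁻¹ ∙ x′)))       ≈⟨ ∙-congˡ (assoc (y ⁻¹) x (x ⁻¹ ∙ x′)) ⟨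
        (y′ ⁻¹ ∙ y) ∙ ((y ⁻¹ ∙ x) ∙ (x ⁻¹ ∙ x′))       ≈⟨ ∙-congˡ (∙-congʳ y⁻¹x≈hak) ⟩
        (y′ ⁻¹ ∙ y) ∙ ((h ∙ a ∙ k) ∙ (x ⁻¹ ∙ x′))      ≈⟨ ∙-congˡ (assoc (h ∙ a) k (x ⁻¹ ∙ x′)) ⟩
        (y′ ⁻¹ ∙ y) ∙ ((h ∙ a) ∙ (k ∙ (x ⁻¹ ∙ x′)))    ≈⟨ assoc (y′ ⁻¹ ∙ y) (h ∙ a) (k ∙ (x ⁻¹ ∙ x′)) ⟨
        ((y′ ⁻¹ ∙ y) ∙ (h ∙ a)) ∙ (k ∙ (x ⁻¹ ∙ x′))    ≈⟨ ∙-congʳ (assoc (y′ ⁻¹ ∙ y) h a) ⟨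
        (y′ ⁻¹ ∙ y) ∙ h ∙ a ∙ (k ∙ (x ⁻¹ ∙ x′))        ∎)

module GroupRing (Γ : AbelianGroup 0ℓ 0ℓ) (finite : Finite (AbelianGroup.setoid Γ)) where
  open AbelianGroup Γ renaming (sym to ≈-sym; trans to ≈-trans)
  open Finiteness finite
  open Sum ℂ.+-commutativeMonoid using (sum; sum-cong-≋)

  ∑[_] : (Carrier → ℂ.Carrier) → ℂ.Carrier
  ∑[ f ] = sum (λ i → f (enumerate i))

  ∑-cong : {f g : Carrier → ℂ.Carrier} → (∀ x → f x ℂ.≈ g x) → ∑[ f ] ℂ.≈ ∑[ g ]
  ∑-cong f≈g = sum-cong-≋ λ i → f≈g (enumerate i)

  -- f represents the formal sum of (f x) x over x ∈ Γ.
  ℂ[Γ] : Set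
  ℂ[Γ] = Func setoid ℂ.setoid

  open Func renaming (to to infixl 20 _at_)

  infix 4 _≋_
  _≋_ : ℂ[Γ] → ℂ[Γ] → Set
  f ≋ g = ∀ x → f at x ℂ.≈ g at x

  𝟘 : ℂ[Γ]
  𝟘 = record { to = λ _ → ℂ.0# ; cong = λ _ → ℂ.refl }

  ⟨_⟩ : Carrier → ℂ[Γ]
  ⟨ g ⟩ = record
    { to   = λ x → indicator (g ≟ x)
    ; cong = λ {x} {y} x≈y →
        indicator-cong (λ p → ≈-trans p x≈y) (λ p → ≈-trans p (≈-sym x≈y)) (g ≟ x) (g ≟ y)
    }

  infixl 7 _⊛_
  _⊛_ : ℂ[Γ] → ℂ[Γ] → ℂ[Γ]
  f ⊛ g = record
    { to   = λ x → ∑[ (λ y → f at y ℂ.* g at (y ⁻¹ ∙ x)) ]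
    ; cong = λ x≈x′ → ∑-cong λ y → ℂ.*-congˡ {f at y} (Func.cong g (∙-congˡ {y ⁻¹} x≈x′))
    }

  ∑ᶠ : ∀ {n} → (Fin n → ℂ[Γ]) → ℂ[Γ]
  ∑ᶠ f = record
    { to   = λ x → sum (λ i → f i at x)
    ; cong = λ x≈y → sum-cong-≋ λ i → Func.cong (f i) x≈y
    }

  Matrix : ℕ → Set
  Matrix n = Fin n → Fin n → ℂ[Γ]

  𝟙 : ∀ {n} → Matrix n
  𝟙 i j = if does (i Fin.≟ j) then ⟨ ε ⟩ else 𝟘

  infixl 7 _⊠_
  _⊠_ : ∀ {n} → Matrix n → Matrix n → Matrix n
  (M ⊠ N) i j = ∑ᶠ λ k → M i k ⊛ N k j

  infixr 8 _·_
  _·_ : ∀ {n} → Carrier → Matrix n → Matrix n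
  (g · M) i j = ⟨ g ⟩ ⊛ M i j

  -- M is a ℂ-linear combination of the matrices gI and gB with g ∈ Γ.
  InSpan : ∀ {n} → Matrix n → Matrix n → Set
  InSpan B M = ∃₂ λ (c d : Carrier → ℂ.Carrier) → ∀ i j x →
    M i j at x ℂ.≈ ∑[ (λ g → c g ℂ.* (g · 𝟙) i j at x ℂ.+ d g ℂ.* (g · B) i j at x) ]

  record IsRoux {n} (B : Matrix n) : Set where
    field
      R1 : ∀ i → B i i ≋ 𝟘
      R2 : ∀ {i j} → i ≢ j → ∃ λ g → B i j ≋ ⟨ g ⟩
      R3 : ∀ {i j} → i ≢ j → ∀ {g} → B i j ≋ ⟨ g ⟩ → B j i ≋ ⟨ g ⁻¹ ⟩
      R4 : ∀ {M N} → InSpan B M → InSpan B N → InSpan B (M ⊠ N)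

  -- The (g , h) entry of the image of x ∈ Γ is 1 if x h = g and 0 otherwise.
  cayley : ℂ[Γ] → SquareMatrix setoid
  cayley f = record
    { to   = λ (g , h) → ∑[ (λ x → f at x ℂ.* indicator (x ∙ h ≟ g)) ]
    ; cong = λ {(g , h)} {(g′ , h′)} (g≈g′ , h≈h′) → ∑-cong λ x → ℂ.*-congˡ {f at x} (indicator-cong
        (λ p → ≈-trans (∙-congˡ (≈-sym h≈h′)) (≈-trans p g≈g′))
        (λ p → ≈-trans (∙-congˡ h≈h′) (≈-trans p (≈-sym g≈g′)))
        (x ∙ h ≟ g) (x ∙ h′ ≟ g′))
    }

  ⌈_⌋ : ∀ {n} → Matrix n → SquareMatrix (≡.setoid (Fin n) ×ₛ setoid)
  ⌈ M ⌋ = record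
    { to   = λ ((i , g) , (j , h)) → Func.to (cayley (M i j)) (g , h)
    ; cong = λ { {(i , _) , (j , _)} ((≡.refl , p) , (≡.refl , q)) → Func.cong (cayley (M i j)) (p , q) }
    }

record Roux : Set₁ where
  field
    Γ      : AbelianGroup 0ℓ 0ℓ
    finite : Finite (AbelianGroup.setoid Γ)
    size   : ℕ
    B      : GroupRing.Matrix Γ finite size
    isRoux : GroupRing.IsRoux Γ finite B

-- A 2 × 2 roux is degenerate: all 2 |Γ| adjacency matrices are permutation matrices.  For
-- trivial Γ the scheme is {I , J - I}, which is also the Schurian scheme of (C₂ , 1), yet
-- (C₂ , 1) is not a Higman pair because 1 is normal in C₂.
rouxScheme : Roux → MatrixFamily
rouxScheme R = record
  { points    = ≡.setoid (Fin size) ×ₛ setoid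
  ; Index     = Carrier ⊎ Carrier
  ; adjacency = λ { (inj₁ g) → ⌈ g · 𝟙 ⌋ ; (inj₂ g) → ⌈ g · B ⌋ }
  }
  where
  open Roux R
  open AbelianGroup Γ using (Carrier; setoid)
  open GroupRing Γ finite

{-# OPTIONS --safe #-}

-- Both schemes are partitions of the pairs of points: two pairs of cosets xH, yH lie in the
-- same Schurian class when the elements y⁻¹x lie in the same double coset.
--
-- Given an isomorphism, G acts on the points of the roux scheme preserving classes, hence on
-- the n fibres.  The stabilizer of a fibre normalizes H because it acts as Γ there, and it is
-- all of K = N(H) because for n ≥ 3 a point has several neighbours in each class ⌈gB⌋.  The
-- element b is a neighbour of the base point in the class ⌈B⌋.
--
-- Conversely, for a Higman pair G is the disjoint union of the HaH = aH and the HabH with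
-- a ∈ K / H.  With representatives r i of G / K, the points of G / H are r i k H with
-- k ∈ Γ = K / H, and the entry β i j of the roux is the a for which (r i)⁻¹ (r j) ∈ HabH.
-- The span in R4 is then the Hecke algebra of H-biinvariant functions on G, and it is closed
-- under products because these are convolutions over G / H.

module Submission where

open import Algebra.Bundles using (AbelianGroup; Group)
import Algebra.Properties.AbelianGroup as AbelianGroupProperties
import Algebra.Properties.CommutativeMonoid.Sum as Sum
import Algebra.Properties.Group as GroupProperties
open import Data.Bool.Base using (Bool; true; false; not; if_then_else_)
open import Data.Fin.Base using (Fin; zero; suc; _↑ˡ_; _↑ʳ_; combine; remQuot; punchIn)
open import Data.Fin.Permutation using (permutation)
import Data.Fin.Properties as Fin
open import Data.List.Base using (List; []; _∷_)
open import Data.Nat.Base as ℕ using (ℕ; zero; suc)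
open import Data.Product.Base using (∃; _×_; _,_; proj₁; proj₂)
open import Data.Product.Function.NonDependent.Setoid using (_×-inverse_)
open import Data.Product.Relation.Binary.Pointwise.NonDependent using (_×ₛ_)
open import Data.Sum.Base using (_⊎_; inj₁; inj₂)
open import Data.Vec.Base using (Vec; lookup)
open import Function.Base using (_∘_)
open import Function.Bundles using (Equivalence; Func; Inverse; _⇔_; mk⇔)
import Function.Construct.Composition as Composition
import Function.Construct.Identity as Identity
open import Level using (0ℓ)
open import Relation.Binary.Bundles using (Setoid)
open import Relation.Binary.Definitions using () renaming (Decidable to Decidable₂)
open import Relation.Binary.PropositionalEquality as ≡ using (_≡_; _≢_)
import Relation.Binary.Reasoning.Setoid as ≈-Reasoning
import Relation.Binary.Reflection as Reflection
open import Relation.Nullary.Decidable using (Dec; yes; no; does; ¬?; map′; _×-dec_; _→-dec_)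
open import Relation.Nullary.Negation using (¬_; contradiction)
open import Relation.Unary using (Decidable; _≐_)
open import Defs

-- Identities in groups, decided by free reduction.

infixl 7 _⊕_
infix  8 ⊝_

data Word (n : ℕ) : Set where
  var : Fin n → Word n
  e   : Word n
  _⊕_ : Word n → Word n → Word n
  ⊝_  : Word n → Word n

-- A generator together with its sign; true stands for the generator itself.
Letter : ℕ → Set
Letter n = Bool × Fin n

-- Only letters of opposite sign need their generators compared. Freely reduced lists stay freely
-- reduced, so words that agree in the free group reach the same list and `solve` closes by `refl`.
push : ∀ {n} → Letter n → List (Letter n) → List (Letter n)
push l [] = l ∷ []
push (true , x) ((true , y) ∷ w) = (true , x) ∷ (true , y) ∷ w
push (false , x) ((false , y) ∷ w) = (false , x) ∷ (false , y) ∷ w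
push (true , x) ((false , y) ∷ w) with x Fin.≟ y
... | yes _ = w
... | no _  = (true , x) ∷ (false , y) ∷ w
push (false , x) ((true , y) ∷ w) with x Fin.≟ y
... | yes _ = w
... | no _  = (false , x) ∷ (true , y) ∷ w

-- The list is the reduced word to the right. The Boolean carries inversion down to the letters;
-- when it is `false` the factors of a product are taken in the opposite order.
reduce : ∀ {n} → Word n → Bool → List (Letter n) → List (Letter n)
reduce (var x) b w     = push (b , x) w
reduce e b w           = w
reduce (u ⊕ v) true w  = reduce u true (reduce v true w)
reduce (u ⊕ v) false w = reduce v false (reduce u false w)
reduce (⊝ u) b w       = reduce u (not b) w

module FreeGroupSolver (G : Group 0ℓ 0ℓ) where
  open Group G
  open GroupProperties G
  open ≈-Reasoning setoid

  ⟦_⟧ : ∀ {n} → Word n → Vec Carrier n → Carrier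
  ⟦ var x ⟧ ρ = lookup ρ x
  ⟦ e ⟧ ρ     = ε
  ⟦ u ⊕ v ⟧ ρ = ⟦ u ⟧ ρ ∙ ⟦ v ⟧ ρ
  ⟦ ⊝ u ⟧ ρ   = ⟦ u ⟧ ρ ⁻¹

  signed : Bool → Carrier → Carrier
  signed true x  = x
  signed false x = x ⁻¹

  ⟦_⟧ᴸ : ∀ {n} → List (Letter n) → Vec Carrier n → Carrier
  ⟦ [] ⟧ᴸ ρ          = ε
  ⟦ (b , x) ∷ w ⟧ᴸ ρ = signed b (lookup ρ x) ∙ ⟦ w ⟧ᴸ ρ

  push-sound : ∀ {n} b (x : Fin n) w ρ → ⟦ push (b , x) w ⟧ᴸ ρ ≈ signed b (lookup ρ x) ∙ ⟦ w ⟧ᴸ ρ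
  push-sound b x [] ρ = refl
  push-sound true x ((true , y) ∷ w) ρ = refl
  push-sound false x ((false , y) ∷ w) ρ = refl
  push-sound true x ((false , y) ∷ w) ρ with x Fin.≟ y
  ... | yes ≡.refl = sym (\\-leftDividesˡ (lookup ρ x) (⟦ w ⟧ᴸ ρ))
  ... | no _       = refl
  push-sound false x ((true , y) ∷ w) ρ with x Fin.≟ y
  ... | yes ≡.refl = sym (\\-leftDividesʳ (lookup ρ x) (⟦ w ⟧ᴸ ρ))
  ... | no _       = refl

  signed-not : ∀ b x → signed b (x ⁻¹) ≈ signed (not b) x
  signed-not true x  = refl
  signed-not false x = ⁻¹-involutive x

  reduce-sound : ∀ {n} (u : Word n) b w ρ → ⟦ reduce u b w ⟧ᴸ ρ ≈ signed b (⟦ u ⟧ ρ) ∙ ⟦ w ⟧ᴸ ρ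
  reduce-sound (var x) b w ρ = push-sound b x w ρ
  reduce-sound e true w ρ = sym (identityˡ _)
  reduce-sound e false w ρ = sym (trans (∙-congʳ ε⁻¹≈ε) (identityˡ _))
  reduce-sound (u ⊕ v) true w ρ = begin
    ⟦ reduce u true (reduce v true w) ⟧ᴸ ρ ≈⟨ reduce-sound u true _ ρ ⟩
    ⟦ u ⟧ ρ ∙ ⟦ reduce v true w ⟧ᴸ ρ       ≈⟨ ∙-congˡ (reduce-sound v true w ρ) ⟩
    ⟦ u ⟧ ρ ∙ (⟦ v ⟧ ρ ∙ ⟦ w ⟧ᴸ ρ)         ≈⟨ assoc _ _ _ ⟨
    (⟦ u ⟧ ρ ∙ ⟦ v ⟧ ρ) ∙ ⟦ w ⟧ᴸ ρ         ∎
  reduce-sound (u ⊕ v) false w ρ = begin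
    ⟦ reduce v false (reduce u false w) ⟧ᴸ ρ   ≈⟨ reduce-sound v false _ ρ ⟩
    ⟦ v ⟧ ρ ⁻¹ ∙ ⟦ reduce u false w ⟧ᴸ ρ       ≈⟨ ∙-congˡ (reduce-sound u false w ρ) ⟩
    ⟦ v ⟧ ρ ⁻¹ ∙ (⟦ u ⟧ ρ ⁻¹ ∙ ⟦ w ⟧ᴸ ρ)       ≈⟨ assoc _ _ _ ⟨
    (⟦ v ⟧ ρ ⁻¹ ∙ ⟦ u ⟧ ρ ⁻¹) ∙ ⟦ w ⟧ᴸ ρ       ≈⟨ ∙-congʳ (⁻¹-anti-homo-∙ _ _) ⟨
    (⟦ u ⟧ ρ ∙ ⟦ v ⟧ ρ) ⁻¹ ∙ ⟦ w ⟧ᴸ ρ          ∎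
  reduce-sound (⊝ u) b w ρ = trans (reduce-sound u (not b) w ρ) (∙-congʳ (sym (signed-not b _)))

  ⟦_⇓⟧ : ∀ {n} → Word n → Vec Carrier n → Carrier
  ⟦ u ⇓⟧ = ⟦ reduce u true [] ⟧ᴸ

  ⇓-sound : ∀ {n} (u : Word n) ρ → ⟦ u ⇓⟧ ρ ≈ ⟦ u ⟧ ρ
  ⇓-sound u ρ = trans (reduce-sound u true [] ρ) (identityʳ _)

  open Reflection setoid var ⟦_⟧ ⟦_⇓⟧ ⇓-sound public using (solve; _⊜_)

-- Indicators and finite sums of complex numbers.

open Sum ℂ.+-commutativeMonoid using (sum; sum-cong-≋; sum-remove; sum-permute; sum-replicate-zero)

indicator-true : ∀ {A : Set} (a? : Dec A) → A → indicator a? ℂ.≈ ℂ.1#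
indicator-true (yes _) a = ℂ.refl
indicator-true (no ¬a) a = contradiction a ¬a

indicator-false : ∀ {A : Set} (a? : Dec A) → ¬ A → indicator a? ℂ.≈ ℂ.0#
indicator-false (yes a) ¬a = contradiction a ¬a
indicator-false (no _) ¬a  = ℂ.refl

indicator-⇔ : ∀ {A B : Set} (a? : Dec A) (b? : Dec B) → A ⇔ B → indicator a? ℂ.≈ indicator b?
indicator-⇔ a? b? A⇔B = indicator-cong (Equivalence.to A⇔B) (Equivalence.from A⇔B) a? b?

-- An entry determines its proposition because `1≉0`. This turns equal adjacency matrices into
-- equivalent relations.
indicator-reflects : ∀ {A B : Set} (a? : Dec A) (b? : Dec B) → indicator a? ℂ.≈ indicator b? → A ⇔ B
indicator-reflects (yes a) (yes b) _ = mk⇔ (λ _ → b) (λ _ → a)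
indicator-reflects (yes a) (no _) 1≈0 = contradiction 1≈0 1≉0
indicator-reflects (no _) (yes b) 0≈1 = contradiction (ℂ.sym 0≈1) 1≉0
indicator-reflects (no ¬a) (no ¬b) _ = mk⇔ (λ a → contradiction a ¬a) (λ b → contradiction b ¬b)

sum-zero : ∀ {n} (f : Fin n → ℂ.Carrier) → (∀ i → f i ℂ.≈ ℂ.0#) → sum f ℂ.≈ ℂ.0#
sum-zero {n} f f≈0 = ℂ.trans (sum-cong-≋ f≈0) (sum-replicate-zero n)

sum-unique : ∀ {n} (f : Fin n → ℂ.Carrier) k → (∀ i → k ≢ i → f i ℂ.≈ ℂ.0#) → sum f ℂ.≈ f k
sum-unique {suc n} f k f≈0 = ℂ.trans (sum-remove {i = k} f)
  (ℂ.trans (ℂ.+-congˡ (sum-zero _ λ i → f≈0 (punchIn k i) (Fin.punchInᵢ≢i k i ∘ ≡.sym))) (ℂ.+-identityʳ (f k)))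

sum-↑ : ∀ m {n} (f : Fin (m ℕ.+ n) → ℂ.Carrier) → sum f ℂ.≈ sum (λ i → f (i ↑ˡ n)) ℂ.+ sum (λ j → f (m ↑ʳ j))
sum-↑ zero f    = ℂ.sym (ℂ.+-identityˡ _)
sum-↑ (suc m) f = ℂ.trans (ℂ.+-congˡ (sum-↑ m (f ∘ suc))) (ℂ.sym (ℂ.+-assoc _ _ _))

sum-combine : ∀ m {n} (f : Fin (m ℕ.* n) → ℂ.Carrier) → sum f ℂ.≈ sum (λ i → sum (λ j → f (combine {m} {n} i j)))
sum-combine zero f        = ℂ.refl
sum-combine (suc m) {n} f = ℂ.trans (sum-↑ n f) (ℂ.+-congˡ (sum-combine m (λ i → f (n ↑ʳ i))))

-- The two enumerations differ by a permutation of the indices. Composing one of them with a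
-- bijection yields the changes of variable made in the Hecke algebra.
sum-reindex : ∀ {S : Setoid 0ℓ 0ℓ} {m n} (A : Inverse S (≡.setoid (Fin m))) (B : Inverse S (≡.setoid (Fin n)))
              (f : Func S ℂ.setoid) →
              sum (λ i → Func.to f (Inverse.from A i)) ℂ.≈ sum (λ j → Func.to f (Inverse.from B j))
sum-reindex A B f = ℂ.trans
  (sum-permute _ (permutation (A.to ∘ B.from) (B.to ∘ A.from)
    (λ i → ≡.trans (A.to-cong (B.strictlyInverseʳ _)) (A.strictlyInverseˡ i))
    (λ j → ≡.trans (B.to-cong (A.strictlyInverseʳ _)) (B.strictlyInverseˡ j))))
  (sum-cong-≋ from-to)
  where
  module A = Inverse A
  module B = Inverse B
  from-to : ∀ j → Func.to f (A.from (A.to (B.from j))) ℂ.≈ Func.to f (B.from j)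
  from-to j = Func.cong f (A.strictlyInverseʳ (B.from j))

-- Finite setoids and elements of small finite sets.

×-finite : ∀ {S T : Setoid 0ℓ 0ℓ} → Finite S → Finite T → Finite (S ×ₛ T)
×-finite {S} {T} (m , A) (n , B) = m ℕ.* n , record
  { to        = λ (x , y) → combine (A.to x) (B.to y)
  ; from      = λ k → A.from (proj₁ (remQuot {m} n k)) , B.from (proj₂ (remQuot {m} n k))
  ; to-cong   = λ (p , q) → ≡.cong₂ combine (A.to-cong p) (B.to-cong q)
  ; from-cong = λ { ≡.refl → Setoid.refl (S ×ₛ T) }
  ; inverse   =
      (λ { {k} (p , q) → ≡.trans (≡.cong₂ combine (A.inverseˡ p) (B.inverseˡ q)) (Fin.combine-remQuot {m} n k) }) ,
      (λ { {x , y} ≡.refl →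
           A.inverseʳ (≡.cong proj₁ (Fin.remQuot-combine (A.to x) (B.to y))) ,
           B.inverseʳ (≡.cong proj₂ (Fin.remQuot-combine (A.to x) (B.to y))) })
  }
  where
  module A = Inverse A
  module B = Inverse B

module _ (T : Setoid 0ℓ 0ℓ) (_≟_ : Decidable₂ (Setoid._≈_ T)) where
  open Setoid T

  -- Induction from the tail: the head is kept only if it differs from all values kept so far.
  distinct-values : ∀ {n} (f : Fin n → Carrier) →
                    ∃ λ m → ∃ λ (g : Fin m → Carrier) → (∀ i j → g i ≈ g j → i ≡ j) × (∀ i → ∃ λ j → f i ≈ g j)
  distinct-values {zero} f = 0 , f , (λ ()) , (λ ())
  distinct-values {suc n} f with distinct-values (f ∘ suc)
  ... | m , g , g-injective , f-covered with Fin.any? (λ j → f zero ≟ g j)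
  ...   | yes f₀-covered = m , g , g-injective , λ { zero → f₀-covered ; (suc i) → f-covered i }
  ...   | no f₀-new = suc m , g′ , g′-injective
                    , λ { zero → zero , refl ; (suc i) → let j , p = f-covered i in suc j , p }
    where
    g′ : Fin (suc m) → Carrier
    g′ zero    = f zero
    g′ (suc j) = g j
    g′-injective : ∀ i j → g′ i ≈ g′ j → i ≡ j
    g′-injective zero zero p       = ≡.refl
    g′-injective zero (suc j) p    = contradiction (j , p) f₀-new
    g′-injective (suc i) zero p    = contradiction (i , sym p) f₀-new
    g′-injective (suc i) (suc j) p = ≡.cong suc (g-injective i j p)

  -- The covering list may repeat classes. This enumerates `G / K` and `K / H` out of the
  -- enumeration of `G`.
  covered⇒finite : ∀ {n} (f : Fin n → Carrier) → (∀ x → ∃ λ i → x ≈ f i) → Finite T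
  covered⇒finite f covers with distinct-values f
  ... | m , g , g-injective , f-covered = m , record
    { to        = λ x → proj₁ (index x)
    ; from      = g
    ; to-cong   = λ {x} {y} p → g-injective _ _ (trans (sym (proj₂ (index x))) (trans p (proj₂ (index y))))
    ; from-cong = λ { ≡.refl → refl }
    ; inverse   = (λ {j} p → g-injective _ _ (trans (sym (proj₂ (index _))) p))
                , (λ { {x} ≡.refl → sym (proj₂ (index x)) })
    }
    where
    index : ∀ x → ∃ λ j → x ≈ g j
    index x = let i , p = covers x ; j , q = f-covered i in j , trans p q

Fin2-pigeonhole : ∀ {n} {i j k : Fin n} → i ≢ j → i ≢ k → j ≢ k → n ≢ 2
Fin2-pigeonhole {i = zero}     {zero}     i≢j _ _ ≡.refl = i≢j ≡.refl
Fin2-pigeonhole {i = suc zero} {suc zero} i≢j _ _ ≡.refl = i≢j ≡.refl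
Fin2-pigeonhole {i = zero}     {suc zero} {zero}     _ i≢k _ ≡.refl = i≢k ≡.refl
Fin2-pigeonhole {i = zero}     {suc zero} {suc zero} _ _ j≢k ≡.refl = j≢k ≡.refl
Fin2-pigeonhole {i = suc zero} {zero}     {zero}     _ _ j≢k ≡.refl = j≢k ≡.refl
Fin2-pigeonhole {i = suc zero} {zero}     {suc zero} _ i≢k _ ≡.refl = i≢k ≡.refl

-- The existence of `i` excludes size 0 and `i ≢ j` excludes size 1, so `n` is at least 3.
third-element : ∀ {n} → n ≢ 2 → {i j : Fin n} → i ≢ j → ∃ λ k → k ≢ i × k ≢ j
third-element {1} _ {zero} {zero} i≢j = contradiction ≡.refl i≢j
third-element {2} n≢2 _ = contradiction ≡.refl n≢2
third-element {suc (suc (suc n))} _ {zero}        {zero}        i≢j = contradiction ≡.refl i≢j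
third-element {suc (suc (suc n))} _ {zero}        {suc zero}    _ = suc (suc zero) , (λ ()) , (λ ())
third-element {suc (suc (suc n))} _ {zero}        {suc (suc _)} _ = suc zero , (λ ()) , (λ ())
third-element {suc (suc (suc n))} _ {suc zero}    {zero}        _ = suc (suc zero) , (λ ()) , (λ ())
third-element {suc (suc (suc n))} _ {suc (suc _)} {zero}        _ = suc zero , (λ ()) , (λ ())
third-element {suc (suc (suc n))} _ {suc _}       {suc _}       _ = zero , (λ ()) , (λ ())

-- The colouring of pairs of points that a roux encodes.

-- The colour inj₁ g stands for the class ⌈gI⌋ and inj₂ g for ⌈gB⌋.
module Colouring (Γ : AbelianGroup 0ℓ 0ℓ) {n : ℕ} (β : Fin n → Fin n → AbelianGroup.Carrier Γ) where
  open AbelianGroup Γ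

  Point : Set
  Point = Fin n × Carrier

  Colour : Carrier ⊎ Carrier → Point → Point → Set
  Colour (inj₁ g) (i , s) (j , t) = i ≡ j × s ≈ g ∙ t
  Colour (inj₂ g) (i , s) (j , t) = i ≢ j × s ≈ g ∙ β i j ∙ t

module RouxEntries (Γ : AbelianGroup 0ℓ 0ℓ) (finite : Finite (AbelianGroup.setoid Γ)) where
  open AbelianGroup Γ
  open AbelianGroupProperties Γ
  open Finiteness finite
  open GroupRing Γ finite

  -- `F` has to respect `≈` because the enumeration only reaches a representative of `y`.
  ∑-unique : (F : Func setoid ℂ.setoid) → ∀ y → (∀ x → ¬ (y ≈ x) → Func.to F x ℂ.≈ ℂ.0#) → ∑[ Func.to F ] ℂ.≈ Func.to F y
  ∑-unique F y F≈0 = ℂ.trans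
    (sum-unique _ (to y) λ i y≢i → F≈0 (enumerate i) λ y≈ → y≢i (≡.trans (to-cong y≈) (strictlyInverseˡ i)))
    (Func.cong F (strictlyInverseʳ y))
    where open Inverse (proj₂ finite)

  _at_ : ℂ[Γ] → Carrier → ℂ.Carrier
  _at_ = Func.to

  ⟨⟩-⊛ : ∀ g f x → (⟨ g ⟩ ⊛ f) at x ℂ.≈ f at (g ⁻¹ ∙ x)
  ⟨⟩-⊛ g f x = ℂ.trans
    (∑-unique summand g λ y g≉y → ℂ.trans (ℂ.*-congʳ (indicator-false (g ≟ y) g≉y)) (ℂ.zeroˡ _))
    (ℂ.trans (ℂ.*-congʳ (indicator-true (g ≟ g) refl)) (ℂ.*-identityˡ _))
    where
    summand : Func setoid ℂ.setoid
    summand = record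
      { to   = λ y → ⟨ g ⟩ at y ℂ.* f at (y ⁻¹ ∙ x)
      ; cong = λ y≈z → ℂ.*-cong (Func.cong ⟨ g ⟩ y≈z) (Func.cong f (∙-congʳ (⁻¹-cong y≈z)))
      }

  -- For given `s` and `t` the equation `x ∙ t ≈ s` has one solution, so each entry of the regular
  -- representation is a single coefficient.
  cayley-entry : ∀ f s t → Func.to (cayley f) (s , t) ℂ.≈ f at (s ∙ t ⁻¹)
  cayley-entry f s t = ℂ.trans
    (∑-unique summand (s ∙ t ⁻¹) λ x st⁻¹≉x → ℂ.trans
      (ℂ.*-congˡ (indicator-false (x ∙ t ≟ s) λ xt≈s → st⁻¹≉x (sym (trans (sym (//-rightDividesʳ t x)) (∙-congʳ xt≈s)))))
      (ℂ.zeroʳ _))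
    (ℂ.trans (ℂ.*-congˡ (indicator-true (s ∙ t ⁻¹ ∙ t ≟ s) (//-rightDividesˡ t s))) (ℂ.*-identityʳ _))
    where
    summand : Func setoid ℂ.setoid
    summand = record
      { to   = λ x → f at x ℂ.* indicator (x ∙ t ≟ s)
      ; cong = λ {x} {y} x≈y → ℂ.*-cong (Func.cong f x≈y)
                 (indicator-cong (trans (∙-congʳ (sym x≈y))) (trans (∙-congʳ x≈y)) (x ∙ t ≟ s) (y ∙ t ≟ s))
      }

  ⟨⟩-injective : ∀ {g h} → ⟨ g ⟩ ≋ ⟨ h ⟩ → g ≈ h
  ⟨⟩-injective {g} {h} p = Equivalence.from (indicator-reflects (g ≟ h) (h ≟ h) (p h)) refl

  -- The diagonal values of β are junk.
  HasEntries : ∀ {n} → Matrix n → (Fin n → Fin n → Carrier) → Set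
  HasEntries B β = (∀ i → B i i ≋ 𝟘) × (∀ {i j} → i ≢ j → B i j ≋ ⟨ β i j ⟩)

  module Entries {n} {B : Matrix n} (β : Fin n → Fin n → Carrier) (entries : HasEntries B β) where
    open Colouring Γ β

    Colour? : ∀ c p q → Dec (Colour c p q)
    Colour? (inj₁ g) (i , s) (j , t) = (i Fin.≟ j) ×-dec (s ≟ g ∙ t)
    Colour? (inj₂ g) (i , s) (j , t) = ¬? (i Fin.≟ j) ×-dec (s ≟ g ∙ β i j ∙ t)

    classMatrix : Carrier ⊎ Carrier → Matrix n
    classMatrix (inj₁ g) = g · 𝟙
    classMatrix (inj₂ g) = g · B

    private
      divide : ∀ {g t x s u} → x ∙ t ≈ s → u ≈ g ⁻¹ ∙ x → s ≈ g ∙ u ∙ t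
      divide {g} {t} {x} xt≈s u≈ = trans (sym xt≈s)
        (∙-congʳ (trans (sym (\\-leftDividesˡ g x)) (∙-congˡ (sym u≈))))
      undivide : ∀ {g t x s u} → x ∙ t ≈ s → s ≈ g ∙ u ∙ t → u ≈ g ⁻¹ ∙ x
      undivide {g} {t} {x} {s} {u} xt≈s s≈ = trans (sym (\\-leftDividesʳ g u))
        (∙-congˡ (∙-cancelʳ t _ _ (trans (sym s≈) (sym xt≈s))))

    -- `x` is free up to `x ∙ t ≈ s`: the choice `s ∙ t ⁻¹` gives the matrix entries, and other
    -- pairs `s`, `t` for the same `x` give the coefficients met in products of matrices.
    entry : ∀ c {i j s t x} → x ∙ t ≈ s → classMatrix c i j at x ℂ.≈ indicator (Colour? c (i , s) (j , t))
    entry (inj₁ g) {i} {j} {s} {t} {x} xt≈s = ℂ.trans (⟨⟩-⊛ g (𝟙 i j) x) 𝟙-entry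
      where
      𝟙-entry : 𝟙 i j at (g ⁻¹ ∙ x) ℂ.≈ indicator (Colour? (inj₁ g) (i , s) (j , t))
      𝟙-entry with i Fin.≟ j
      ... | yes _ = indicator-cong
                      (λ p → trans (divide xt≈s p) (∙-congʳ (identityʳ g)))
                      (λ p → undivide xt≈s (trans p (∙-congʳ (sym (identityʳ g)))))
                      (ε ≟ g ⁻¹ ∙ x) (s ≟ g ∙ t)
      ... | no _ = ℂ.refl
    entry (inj₂ g) {i} {j} {s} {t} {x} xt≈s = ℂ.trans (⟨⟩-⊛ g (B i j) x) B-entry
      where
      B-entry : B i j at (g ⁻¹ ∙ x) ℂ.≈ indicator (Colour? (inj₂ g) (i , s) (j , t))
      B-entry with i Fin.≟ j
      ... | yes ≡.refl = proj₁ entries i _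
      ... | no i≢j = ℂ.trans (proj₂ entries i≢j _)
                       (indicator-cong (divide xt≈s) (undivide xt≈s) (β i j ≟ g ⁻¹ ∙ x) (s ≟ g ∙ β i j ∙ t))

    adjacency-entry : ∀ c p q → Func.to ⌈ classMatrix c ⌋ (p , q) ℂ.≈ indicator (Colour? c p q)
    adjacency-entry c (i , s) (j , t) =
      ℂ.trans (cayley-entry (classMatrix c i j) s t) (entry c (//-rightDividesˡ t s))

-- Double cosets, the normalizer `K` and the quotient `K / H`.

module Cosets {G : Group 0ℓ 0ℓ} (H : Subgroup G) where
  open Group G
  open Subgroup H
  open FreeGroupSolver G

  doubleCoset-refl : ∀ x → doubleCoset H x x
  doubleCoset-refl x = ε , ε , ε-closed , ε-closed , solve 1 (λ x → x ⊜ e ⊕ x ⊕ e) refl x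

  doubleCoset-sym : ∀ {x y} → doubleCoset H x y → doubleCoset H y x
  doubleCoset-sym {x} {y} (h , k , h∈H , k∈H , y≈) = h ⁻¹ , k ⁻¹ , ⁻¹-closed h∈H , ⁻¹-closed k∈H
    , trans (solve 3 (λ h x k → x ⊜ ⊝ h ⊕ (h ⊕ x ⊕ k) ⊕ ⊝ k) refl h x k) (∙-congʳ (∙-congˡ (sym y≈)))

  doubleCoset-trans : ∀ {x y z} → doubleCoset H x y → doubleCoset H y z → doubleCoset H x z
  doubleCoset-trans {x} (h , k , h∈H , k∈H , y≈) (h′ , k′ , h′∈H , k′∈H , z≈) =
    h′ ∙ h , k ∙ k′ , ∙-closed h′∈H h∈H , ∙-closed k∈H k′∈H
    , trans z≈ (trans (∙-congʳ (∙-congˡ y≈))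
        (solve 5 (λ h x k h′ k′ → h′ ⊕ (h ⊕ x ⊕ k) ⊕ k′ ⊜ (h′ ⊕ h) ⊕ x ⊕ (k ⊕ k′)) refl h x k h′ k′))

  doubleCoset-resp : ∀ {x y z} → y ≈ z → doubleCoset H x y → doubleCoset H x z
  doubleCoset-resp y≈z (h , k , h∈H , k∈H , y≈) = h , k , h∈H , k∈H , trans (sym y≈z) y≈

  ε\\-class : ∀ x → doubleCoset H x (ε ⁻¹ ∙ x)
  ε\\-class x = doubleCoset-resp (solve 1 (λ x → x ⊜ ⊝ e ⊕ x) refl x) (doubleCoset-refl x)

  doubleCoset-≐ : ∀ {x y} → doubleCoset H x y → doubleCoset H x ≐ doubleCoset H y
  doubleCoset-≐ xy = doubleCoset-trans (doubleCoset-sym xy) , doubleCoset-trans xy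

module Normalizer {G : Group 0ℓ 0ℓ} (H : Subgroup G) where
  open Group G
  open Subgroup H
  open FreeGroupSolver G
  module K = Subgroup (normalizer H)

  conjugate-∈ : ∀ {g h} → K.Member g → Member h → Member (g ∙ h ∙ g ⁻¹)
  conjugate-∈ (gHg⁻¹⊆H , _) h∈H = gHg⁻¹⊆H (_ , h∈H , refl)

  conjugate⁻¹-∈ : ∀ {g h} → K.Member g → Member h → Member (g ⁻¹ ∙ h ∙ g)
  conjugate⁻¹-∈ {g} {h} g∈K h∈H = respects
    (solve 2 (λ g h → ⊝ g ⊕ h ⊕ ⊝ (⊝ g) ⊜ ⊝ g ⊕ h ⊕ g) refl g h) (conjugate-∈ (K.⁻¹-closed {g} g∈K) h∈H)

  -- The reverse inclusion holds because `x` in `H` is the conjugate by `g` of `g ⁻¹ ∙ x ∙ g`. The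
  -- two hypotheses are exchanged by inverting `g`, so one argument can supply both.
  ∈K-intro : ∀ {g} → (∀ {h} → Member h → Member (g ∙ h ∙ g ⁻¹)) → (∀ {h} → Member h → Member (g ⁻¹ ∙ h ∙ g)) → K.Member g
  ∈K-intro {g} conj conj⁻¹ =
    (λ (h , h∈H , x≈) → respects (sym x≈) (conj h∈H)) ,
    (λ {x} x∈H → g ⁻¹ ∙ x ∙ g , conj⁻¹ x∈H , solve 2 (λ g x → x ⊜ g ⊕ (⊝ g ⊕ x ⊕ g) ⊕ ⊝ g) refl g x)

  -- Opaque, as conversion checking of elements of K / H would otherwise unfold these proofs.
  opaque
    ε∈K : K.Member ε
    ε∈K = K.ε-closed

    ∙∈K : ∀ {x y} → K.Member x → K.Member y → K.Member (x ∙ y)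
    ∙∈K {x} {y} = K.∙-closed {x} {y}

    ⁻¹∈K : ∀ {x} → K.Member x → K.Member (x ⁻¹)
    ⁻¹∈K {x} = K.⁻¹-closed {x}

    H⊆K : ∀ {h} → Member h → K.Member h
    H⊆K h∈H = ∈K-intro (λ k∈H → ∙-closed (∙-closed h∈H k∈H) (⁻¹-closed h∈H))
                       (λ k∈H → ∙-closed (∙-closed (⁻¹-closed h∈H) k∈H) h∈H)

  -- A record instead of bare membership in `H`, so that `x` and `y` can be inferred from a proof.
  record _~_ (x y : ∃ K.Member) : Set where
    constructor mk~
    field member : Member (proj₁ x ⁻¹ ∙ proj₁ y)

  ≈⇒~ : ∀ {x y} → proj₁ x ≈ proj₁ y → x ~ y
  ≈⇒~ {x} p = mk~ (respects (trans (sym (inverseˡ (proj₁ x))) (∙-congˡ p)) ε-closed)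

  module ≈ᴴ = Setoid (leftCosets H)

  quotient : (∀ {x y} → K.Member x → K.Member y → (x ∙ y) ≈ᴴ.≈ (y ∙ x)) → AbelianGroup 0ℓ 0ℓ
  quotient commute = record
    { Carrier = ∃ K.Member
    ; _≈_ = _~_
    ; _∙_ = λ (x , x∈K) (y , y∈K) → x ∙ y , ∙∈K {x} {y} x∈K y∈K
    ; ε   = ε , ε∈K
    ; _⁻¹ = λ (x , x∈K) → x ⁻¹ , ⁻¹∈K {x} x∈K
    ; isAbelianGroup = record
      { isGroup = record
        { isMonoid = record
          { isSemigroup = record
            { isMagma = record
              { isEquivalence = record
                { refl  = ≈⇒~ refl
                ; sym   = λ {x} {y} (mk~ p) → mk~ (≈ᴴ.sym {proj₁ x} {proj₁ y} p)
                ; trans = λ {x} {y} {z} (mk~ p) (mk~ q) → mk~ (≈ᴴ.trans {proj₁ x} {proj₁ y} {proj₁ z} p q)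
                }
              -- The discrepancy between `x` and `x′` has to move past `y`, which is possible
              -- because `y` normalizes `H`.
              ; ∙-cong = λ { {x , _} {x′ , _} {y , y∈K} {y′ , _} (mk~ p) (mk~ q) → mk~ (respects
                  (solve 4 (λ x x′ y y′ → ⊝ y ⊕ (⊝ x ⊕ x′) ⊕ y ⊕ (⊝ y ⊕ y′) ⊜ ⊝ (x ⊕ y) ⊕ (x′ ⊕ y′)) refl x x′ y y′)
                  (∙-closed (conjugate⁻¹-∈ y∈K p) q)) }
              }
            ; assoc = λ x y z → ≈⇒~ (assoc (proj₁ x) (proj₁ y) (proj₁ z))
            }
          ; identity = (λ x → ≈⇒~ (identityˡ (proj₁ x))) , (λ x → ≈⇒~ (identityʳ (proj₁ x)))
          }
        ; inverse = (λ x → ≈⇒~ (inverseˡ (proj₁ x))) , (λ x → ≈⇒~ (inverseʳ (proj₁ x)))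
        ; ⁻¹-cong = λ { {x , x∈K} {y , _} (mk~ p) → mk~ (respects
            (solve 2 (λ x y → x ⊕ ⊝ (⊝ x ⊕ y) ⊕ ⊝ x ⊜ ⊝ (⊝ x) ⊕ ⊝ y) refl x y)
            (conjugate-∈ x∈K (⁻¹-closed p))) }
        }
      ; comm = λ (x , x∈K) (y , y∈K) → mk~ (commute {x} {y} x∈K y∈K)
      }
    }

-- From an isomorphism with a roux scheme to a Higman pair.

module HigmanFromColouring
  {G : Group 0ℓ 0ℓ} (H : Subgroup G) (Γ : AbelianGroup 0ℓ 0ℓ)
  {n : ℕ} (n≢2 : n ≢ 2) (β : Fin n → Fin n → AbelianGroup.Carrier Γ)
  (β-sym : ∀ {i j} → i ≢ j → AbelianGroup._≈_ Γ (β j i) (AbelianGroup._⁻¹ Γ (β i j)))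
  (σ : Inverse (leftCosets H) (≡.setoid (Fin n) ×ₛ AbelianGroup.setoid Γ))
  (classes : ∀ c → ∃ λ a → ∀ x y → doubleCoset H a (Group._∙_ G (Group._⁻¹ G y) x) ⇔
                                   Colouring.Colour Γ β c (Inverse.to σ x) (Inverse.to σ y))
  where
  open Group G
  open Subgroup H
  open FreeGroupSolver G
  open Cosets H
  open Normalizer H
  open Colouring Γ β
  module Γ where
    open AbelianGroup Γ public
    open AbelianGroupProperties Γ public
  module σ = Inverse σ

  π : Carrier → Fin n
  π x = proj₁ (σ.to x)

  s : Carrier → Γ.Carrier
  s x = proj₂ (σ.to x)

  σ-injective : ∀ x y → π x ≡ π y → s x Γ.≈ s y → x ≈ᴴ.≈ y
  σ-injective x y p q = ≈ᴴ.trans {x} {σ.from (σ.to x)} {y}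
    (≈ᴴ.sym {σ.from (σ.to x)} {x} (σ.strictlyInverseʳ x)) (σ.inverseʳ (p , q))

  same-class : ∀ c {x y x′ y′} → Colour c (σ.to x) (σ.to y) → Colour c (σ.to x′) (σ.to y′) →
               doubleCoset H (y ⁻¹ ∙ x) (y′ ⁻¹ ∙ x′)
  same-class c {x} {y} {x′} {y′} p q with classes c
  ... | a , class = doubleCoset-trans (doubleCoset-sym (Equivalence.from (class x y) p)) (Equivalence.from (class x′ y′) q)

  -- Each colour class is the relation of one double coset. Together with `same-class` this lets the
  -- argument pass between `G` and the points of the roux scheme.
  transfer : ∀ c x y x′ y′ → doubleCoset H (y ⁻¹ ∙ x) (y′ ⁻¹ ∙ x′) →
             Colour c (σ.to x) (σ.to y) → Colour c (σ.to x′) (σ.to y′)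
  transfer c x y x′ y′ xy~x′y′ p with classes c
  ... | a , class = Equivalence.to (class x′ y′) (doubleCoset-trans (Equivalence.from (class x y) p) xy~x′y′)

  -- A left translation leaves `y ⁻¹ ∙ x` unchanged, so `G` acts by automorphisms of the colouring.
  translate : ∀ c x y g → Colour c (σ.to x) (σ.to y) → Colour c (σ.to (g ∙ x)) (σ.to (g ∙ y))
  translate c x y g = transfer c x y (g ∙ x) (g ∙ y) (doubleCoset-resp
    (solve 3 (λ g x y → ⊝ y ⊕ x ⊜ ⊝ (g ⊕ y) ⊕ (g ⊕ x)) refl g x y) (doubleCoset-refl (y ⁻¹ ∙ x)))

  σ-cong : ∀ {x y} → x ≈ y → π x ≡ π y × s x Γ.≈ s y
  σ-cong {x} x≈y = σ.to-cong (respects (trans (sym (inverseˡ x)) (∙-congˡ x≈y)) ε-closed)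

  relabel : ∀ c {x y x′ y′} → x ≈ x′ → y ≈ y′ → Colour c (σ.to x) (σ.to y) → Colour c (σ.to x′) (σ.to y′)
  relabel c {x} {y} {x′} {y′} x≈ y≈ = transfer c x y x′ y′
    (doubleCoset-resp (∙-cong (⁻¹-cong y≈) x≈) (doubleCoset-refl (y ⁻¹ ∙ x)))

  fibre-colour : ∀ x y → π x ≡ π y → Colour (inj₁ (s x Γ.∙ s y Γ.⁻¹)) (σ.to x) (σ.to y)
  fibre-colour x y p = p , Γ.sym (Γ.//-rightDividesˡ (s y) (s x))

  cross-colour : ∀ {p q} → proj₁ p ≢ proj₁ q →
                 Colour (inj₂ (proj₂ p Γ.∙ (β (proj₁ p) (proj₁ q) Γ.∙ proj₂ q) Γ.⁻¹)) p q
  cross-colour {i , u} {j , v} i≢j = i≢j ,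
    Γ.sym (Γ.trans (Γ.assoc _ (β i j) v) (Γ.//-rightDividesˡ (β i j Γ.∙ v) u))

  -- Lying in one fibre means having some colour `inj₁`, so translations permute the fibres.
  π-translate : ∀ g x y → π x ≡ π y → π (g ∙ x) ≡ π (g ∙ y)
  π-translate g x y p = proj₁ (translate (inj₁ (s x Γ.∙ s y Γ.⁻¹)) x y g (fibre-colour x y p))

  stabilizes : Carrier → Set
  stabilizes g = π g ≡ π ε

  stabilizes-⁻¹ : ∀ {g} → stabilizes g → stabilizes (g ⁻¹)
  stabilizes-⁻¹ {g} p = ≡.trans (proj₁ (σ-cong (sym (identityʳ (g ⁻¹)))))
    (≡.trans (π-translate (g ⁻¹) ε g (≡.sym p)) (proj₁ (σ-cong (inverseˡ g))))

  -- Seen from the base point, `g` and `h ⁻¹ ∙ g` lie in one double coset and hence share a colour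
  -- `inj₁`. Such a colour determines the point, so both are the same coset of `H`.
  stabilizes-conjugate : ∀ g → stabilizes g → ∀ {h} → Member h → Member (g ⁻¹ ∙ h ∙ g)
  stabilizes-conjugate g p {h} h∈H = respects
    (solve 2 (λ g h → ⊝ (⊝ h ⊕ g) ⊕ g ⊜ ⊝ g ⊕ h ⊕ g) refl g h)
    (σ-injective (h ⁻¹ ∙ g) g (≡.trans (proj₁ hg) (≡.sym p)) (Γ.trans (proj₂ hg) (Γ.sym (proj₂ g-colour))))
    where
    g-colour = fibre-colour g ε p
    hg = transfer (inj₁ (s g Γ.∙ s ε Γ.⁻¹)) g ε (h ⁻¹ ∙ g) ε
      (h ⁻¹ , ε , ⁻¹-closed h∈H , ε-closed , solve 2 (λ g h → ⊝ e ⊕ (⊝ h ⊕ g) ⊜ ⊝ h ⊕ (⊝ e ⊕ g) ⊕ e) refl g h)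
      g-colour

  stabilizes⇒∈K : ∀ g → stabilizes g → K.Member g
  stabilizes⇒∈K g p = ∈K-intro
    (λ {h} h∈H → respects (solve 2 (λ g h → ⊝ (⊝ g) ⊕ h ⊕ ⊝ g ⊜ g ⊕ h ⊕ ⊝ g) refl g h)
       (stabilizes-conjugate (g ⁻¹) (stabilizes-⁻¹ p) h∈H))
    (stabilizes-conjugate g p)

  -- If g normalizes H then HgH = gH is a single point, whereas a roux scheme on n ≥ 3 fibres
  -- relates a point to n - 1 ≥ 2 points in each of the classes ⌈gB⌋.
  ∈K⇒stabilizes : ∀ g → K.Member g → stabilizes g
  ∈K⇒stabilizes g (_ , H⊆gHg⁻¹) with π g Fin.≟ π ε
  ... | yes p = p
  ... | no ¬p with third-element n≢2 ¬p
  ...   | k , k≢πg , k≢πε = contradiction (≡.trans (≡.sym (proj₁ w-at)) (proj₁ (σ.to-cong w~g))) k≢πg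
    where
    c = s g Γ.∙ (β (π g) (π ε) Γ.∙ s ε) Γ.⁻¹
    w = σ.from (k , c Γ.∙ β k (π ε) Γ.∙ s ε)
    w-at = σ.strictlyInverseˡ (k , c Γ.∙ β k (π ε) Γ.∙ s ε)
    w-colour : Colour (inj₂ c) (σ.to w) (σ.to ε)
    w-colour with σ.to w | w-at
    ... | _ , t | ≡.refl , t≈ = k≢πε , t≈
    w~g : w ≈ᴴ.≈ g
    w~g with same-class (inj₂ c) {g} {ε} {w} {ε} (cross-colour ¬p) w-colour
    ... | h , h′ , h∈H , h′∈H , w≈ with H⊆gHg⁻¹ h∈H
    ...   | k , k∈H , h≈ = respects
      (trans (solve 4 (λ g h k h′ → ⊝ (k ⊕ h′) ⊜ ⊝ (e ⊕ ((g ⊕ k ⊕ ⊝ g) ⊕ (⊝ e ⊕ g) ⊕ h′)) ⊕ g) refl g h k h′)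
        (∙-congʳ (⁻¹-cong (sym (trans (solve 1 (λ w → w ⊜ e ⊕ (⊝ e ⊕ w)) refl w)
                                      (∙-congˡ (trans w≈ (∙-congʳ (∙-congʳ h≈)))))))))
      (⁻¹-closed (∙-closed k∈H h′∈H))

  b : Carrier
  b = proj₁ (classes (inj₂ Γ.ε))

  b-colour : Colour (inj₂ Γ.ε) (σ.to b) (σ.to ε)
  b-colour = Equivalence.to (proj₂ (classes (inj₂ Γ.ε)) b ε)
    (ε\\-class b)

  b∉K : ¬ K.Member b
  b∉K b∈K = proj₁ b-colour (∈K⇒stabilizes b b∈K)

  -- Transposition turns the colour `inj₂ g` into `inj₂ (g ⁻¹)`, by the symmetry of `β`, and `ε` is
  -- its own inverse.
  colour-sym : ∀ p q → Colour (inj₂ Γ.ε) p q → Colour (inj₂ Γ.ε) q p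
  colour-sym (i , u) (j , v) (i≢j , u≈) = i≢j ∘ ≡.sym , (begin
    v                            ≈⟨ Γ.\\-leftDividesʳ (β i j) v ⟨
    β i j Γ.⁻¹ Γ.∙ (β i j Γ.∙ v) ≈⟨ Γ.∙-cong (β-sym i≢j) (Γ.∙-congʳ (Γ.identityˡ (β i j))) ⟨
    β j i Γ.∙ (Γ.ε Γ.∙ β i j Γ.∙ v) ≈⟨ Γ.∙-cong (Γ.identityˡ (β j i)) u≈ ⟨
    Γ.ε Γ.∙ β j i Γ.∙ u          ∎)
    where open ≈-Reasoning Γ.setoid

  -- Translation by `x ⁻¹` moves the fibre to the base fibre. Contrapositively, distinct cosets of
  -- `K` lie in distinct fibres.
  same-fibre⇒≈ᴷ : ∀ x y → π x ≡ π y → K.Member (x ⁻¹ ∙ y)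
  same-fibre⇒≈ᴷ x y p = stabilizes⇒∈K _
    (≡.trans (π-translate (x ⁻¹) y x (≡.sym p)) (proj₁ (σ-cong (inverseˡ x))))

  -- In the fibre of `y` there is a point `w` that is related to `y′` by the colour of `x` and `x′`.
  -- The two pairs then share a double coset, hence an orbit of `G`.
  doublyTransitive : DoublyTransitive G (leftCosets (normalizer H)) _∙_
  doublyTransitive x x′ y y′ x≉x′ y≉y′ = g
    , same-fibre⇒≈ᴷ (g ∙ x) y gx
    , same-fibre⇒≈ᴷ (g ∙ x′) y′ gx′
    where
    c = s x Γ.∙ (β (π x) (π x′) Γ.∙ s x′) Γ.⁻¹
    x-colour : Colour (inj₂ c) (σ.to x) (σ.to x′)
    x-colour = cross-colour λ p → x≉x′ (same-fibre⇒≈ᴷ x x′ p)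
    target = π y , c Γ.∙ β (π y) (π y′) Γ.∙ s y′
    w = σ.from target
    w-at = σ.strictlyInverseˡ target
    w-colour : Colour (inj₂ c) (σ.to w) (σ.to y′)
    w-colour with σ.to w | w-at
    ... | _ , t | ≡.refl , t≈ = (λ p → y≉y′ (same-fibre⇒≈ᴷ y y′ p)) , t≈
    related = same-class (inj₂ c) {x} {x′} {w} {y′} x-colour w-colour
    h = proj₁ related
    k = proj₁ (proj₂ related)
    -- From `y′ ⁻¹ ∙ w ≈ h ∙ (x′ ⁻¹ ∙ x) ∙ k` this choice gives `g ∙ x ∙ k ≈ w` and
    -- `g ∙ x′ ≈ y′ ∙ h`.
    g = y′ ∙ h ∙ x′ ⁻¹
    gx : π (g ∙ x) ≡ π y
    gx = ≡.trans (proj₁ (σ.to-cong gx~w)) (proj₁ w-at)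
      where
      gx~w : (g ∙ x) ≈ᴴ.≈ w
      gx~w = respects
        (trans (solve 5 (λ x x′ y′ h k → k ⊜ ⊝ (y′ ⊕ h ⊕ ⊝ x′ ⊕ x) ⊕ (y′ ⊕ (h ⊕ (⊝ x′ ⊕ x) ⊕ k))) refl x x′ y′ h k)
          (∙-congˡ (trans (∙-congˡ (sym (proj₂ (proj₂ (proj₂ (proj₂ related))))))
            (solve 2 (λ w y′ → y′ ⊕ (⊝ y′ ⊕ w) ⊜ w) refl w y′))))
        (proj₁ (proj₂ (proj₂ (proj₂ related))))
    gx′ : π (g ∙ x′) ≡ π y′
    gx′ = proj₁ (σ.to-cong (respects
      (solve 3 (λ x′ y′ h → ⊝ h ⊜ ⊝ (y′ ⊕ h ⊕ ⊝ x′ ⊕ x′) ⊕ y′) refl x′ y′ h)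
      (⁻¹-closed (proj₁ (proj₂ (proj₂ related))))))

  ratio : Carrier → Γ.Carrier
  ratio x = s x Γ.∙ s ε Γ.⁻¹

  -- The pair `x ∙ a`, `x` is the translate by `x` of `a`, `ε`. Thus `K` acts from the right through
  -- Γ, and H2 follows from the commutativity of Γ.
  stabilizes-act : ∀ x a → stabilizes a → π (x ∙ a) ≡ π x × s (x ∙ a) Γ.≈ ratio a Γ.∙ s x
  stabilizes-act x a p =
    let q , r = translate (inj₁ (ratio a)) a ε x (fibre-colour a ε p)
        q′ , r′ = σ-cong (identityʳ x)
    in ≡.trans q q′ , Γ.trans r (Γ.∙-congˡ r′)

  commute : ∀ {x y} → K.Member x → K.Member y → (x ∙ y) ≈ᴴ.≈ (y ∙ x)
  commute {x} {y} x∈K y∈K = σ-injective (x ∙ y) (y ∙ x)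
    (≡.trans (proj₁ xy) (≡.trans p (≡.trans (≡.sym q) (≡.sym (proj₁ yx))))) (begin
      s (x ∙ y)                         ≈⟨ proj₂ xy ⟩
      ratio y Γ.∙ s x                   ≈⟨ Γ.∙-congˡ (proj₂ (fibre-colour x ε p)) ⟩
      ratio y Γ.∙ (ratio x Γ.∙ s ε)     ≈⟨ Γ.assoc _ _ _ ⟨
      ratio y Γ.∙ ratio x Γ.∙ s ε       ≈⟨ Γ.∙-congʳ (Γ.comm _ _) ⟩
      ratio x Γ.∙ ratio y Γ.∙ s ε       ≈⟨ Γ.assoc _ _ _ ⟩
      ratio x Γ.∙ (ratio y Γ.∙ s ε)     ≈⟨ Γ.∙-congˡ (proj₂ (fibre-colour y ε q)) ⟨
      ratio x Γ.∙ s y                   ≈⟨ proj₂ yx ⟨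
      s (y ∙ x)                         ∎)
    where
    open ≈-Reasoning Γ.setoid
    p = ∈K⇒stabilizes x x∈K
    q = ∈K⇒stabilizes y y∈K
    xy = stabilizes-act x y q
    yx = stabilizes-act y x p

  -- Translating `b`, `ε` by `b ⁻¹` gives `ε`, `b ⁻¹`, and the colour of `B` is symmetric.
  inverse-class : doubleCoset H b (b ⁻¹)
  inverse-class = doubleCoset-trans
    (ε\\-class b)
    (doubleCoset-resp (solve 1 (λ b → ⊝ e ⊕ ⊝ b ⊜ ⊝ b) refl b)
      (same-class (inj₂ Γ.ε) {b} {ε} {b ⁻¹} {ε} b-colour
        (colour-sym (σ.to ε) (σ.to (b ⁻¹))
          (relabel (inj₂ Γ.ε) (inverseˡ b) (identityʳ (b ⁻¹)) (translate (inj₂ Γ.ε) b ε (b ⁻¹) b-colour)))))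

  -- Right multiplication by `a ⁻¹` multiplies the Γ-coordinates of `b` and `ε` by the same `ratio`.
  -- Commutativity of Γ then preserves their colour, and the new pair has quotient `a ∙ b ∙ a ⁻¹`.
  conjugate-class : ∀ {a} → K.Member a → doubleCoset H b (a ∙ b ∙ a ⁻¹)
  conjugate-class {a} a∈K = doubleCoset-trans
    (ε\\-class b)
    (doubleCoset-resp (solve 2 (λ a b → ⊝ (⊝ a) ⊕ (b ⊕ ⊝ a) ⊜ a ⊕ b ⊕ ⊝ a) refl a b)
      (same-class (inj₂ Γ.ε) {b} {ε} {b ∙ a ⁻¹} {a ⁻¹} b-colour ba⁻¹-colour))
    where
    open ≈-Reasoning Γ.setoid
    p = stabilizes-⁻¹ (∈K⇒stabilizes a a∈K)
    ba⁻¹ = stabilizes-act b (a ⁻¹) p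
    c = ratio (a ⁻¹)
    ba⁻¹-colour : Colour (inj₂ Γ.ε) (σ.to (b ∙ a ⁻¹)) (σ.to (a ⁻¹))
    ba⁻¹-colour = (λ q → proj₁ b-colour (≡.trans (≡.sym (proj₁ ba⁻¹)) (≡.trans q p))) , (begin
      s (b ∙ a ⁻¹)                            ≈⟨ proj₂ ba⁻¹ ⟩
      c Γ.∙ s b                               ≈⟨ Γ.∙-congˡ (proj₂ b-colour) ⟩
      c Γ.∙ (Γ.ε Γ.∙ β (π b) (π ε) Γ.∙ s ε)   ≈⟨ Γ.assoc _ _ _ ⟨
      c Γ.∙ (Γ.ε Γ.∙ β (π b) (π ε)) Γ.∙ s ε   ≈⟨ Γ.∙-congʳ (Γ.comm _ _) ⟩
      Γ.ε Γ.∙ β (π b) (π ε) Γ.∙ c Γ.∙ s ε     ≈⟨ Γ.assoc _ _ _ ⟩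
      Γ.ε Γ.∙ β (π b) (π ε) Γ.∙ (c Γ.∙ s ε)   ≈⟨ Γ.∙-congˡ (proj₂ (fibre-colour (a ⁻¹) ε p)) ⟨
      Γ.ε Γ.∙ β (π b) (π ε) Γ.∙ s (a ⁻¹)      ≡⟨ ≡.cong₂ (λ i j → Γ.ε Γ.∙ β i j Γ.∙ s (a ⁻¹)) (proj₁ ba⁻¹) p ⟨
      Γ.ε Γ.∙ β (π (b ∙ a ⁻¹)) (π (a ⁻¹)) Γ.∙ s (a ⁻¹) ∎)

  -- The assumption gives `b`, `a ⁻¹` the colour of `b`, `ε`. Within the base fibre only one point
  -- is in this relation to `b`, so `a ⁻¹` and `ε` are the same coset.
  class-stabilizer : ∀ {a} → K.Member a → doubleCoset H b (a ∙ b) → Member a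
  class-stabilizer {a} a∈K ab∈HbH = respects (solve 1 (λ a → ⊝ (⊝ a) ⊕ e ⊜ a) refl a)
    (σ-injective (a ⁻¹) ε p (Γ.∙-cancelˡ (Γ.ε Γ.∙ β (π b) (π ε)) _ _ (begin
      Γ.ε Γ.∙ β (π b) (π ε) Γ.∙ s (a ⁻¹)      ≡⟨ ≡.cong (λ i → Γ.ε Γ.∙ β (π b) i Γ.∙ s (a ⁻¹)) p ⟨
      Γ.ε Γ.∙ β (π b) (π (a ⁻¹)) Γ.∙ s (a ⁻¹) ≈⟨ proj₂ b-a⁻¹ ⟨
      s b                                     ≈⟨ proj₂ b-colour ⟩
      Γ.ε Γ.∙ β (π b) (π ε) Γ.∙ s ε           ∎)))
    where
    open ≈-Reasoning Γ.setoid
    p = stabilizes-⁻¹ (∈K⇒stabilizes a a∈K)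
    b-a⁻¹ : Colour (inj₂ Γ.ε) (σ.to b) (σ.to (a ⁻¹))
    b-a⁻¹ = transfer (inj₂ Γ.ε) b ε b (a ⁻¹)
      (doubleCoset-trans (doubleCoset-sym (ε\\-class b))
       (doubleCoset-resp (solve 2 (λ a b → a ⊕ b ⊜ ⊝ (⊝ a) ⊕ b) refl a b) ab∈HbH))
      b-colour

  higmanPair : HigmanPair G H
  higmanPair = record
    { proper = b , b∉K ∘ H⊆K
    ; b      = b
    ; b∉K    = b∉K
    ; H1     = doublyTransitive
    ; H2     = commute
    ; H3     = doubleCoset-≐ inverse-class
    ; H4     = conjugate-class
    ; H5     = class-stabilizer
    }

-- The double cosets of a Higman pair.

module HigmanClasses {G : Group 0ℓ 0ℓ} {H : Subgroup G} (higman : HigmanPair G H) where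
  open Group G
  open Subgroup H
  open FreeGroupSolver G
  open Cosets H
  open Normalizer H
  open HigmanPair higman

  Γ : AbelianGroup 0ℓ 0ℓ
  Γ = quotient H2

  module Γ where
    open AbelianGroup Γ public
    open AbelianGroupProperties Γ public

  Class : Γ.Carrier → Carrier → Set
  Class a = doubleCoset H (proj₁ a ∙ b)

  b⁻¹-class : doubleCoset H b (b ⁻¹)
  b⁻¹-class = proj₂ H3 (doubleCoset-refl (b ⁻¹))

  Class-ε : doubleCoset H b ≐ Class Γ.ε
  Class-ε = doubleCoset-≐ (doubleCoset-resp (sym (identityˡ b)) (doubleCoset-refl b))

  -- `a` is `a′` times an element of `H`, and conjugation by `a′` carries that element to the left
  -- end.
  Class-resp : ∀ {a a′ z} → a Γ.≈ a′ → Class a z → Class a′ z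
  Class-resp {a , a∈K} {a′ , a′∈K} (mk~ p) = doubleCoset-trans
    (a′ ∙ (a ⁻¹ ∙ a′) ⁻¹ ∙ a′ ⁻¹ , ε , conjugate-∈ a′∈K (⁻¹-closed p) , ε-closed
    , solve 3 (λ a a′ b → a ⊕ b ⊜ a′ ⊕ ⊝ (⊝ a ⊕ a′) ⊕ ⊝ a′ ⊕ (a′ ⊕ b) ⊕ e) refl a a′ b)

  -- K normalizes H, and b commutes with K modulo H by H4.
  Class-act : ∀ k l {a z} → Class a z → Class (k Γ.∙ a Γ.∙ l) (proj₁ k ∙ z ∙ proj₁ l)
  Class-act (k , k∈K) (l , l∈K) {a , a∈K} {z} (h , h′ , h∈H , h′∈H , z≈) = absorb (H4 (⁻¹∈K {l} l∈K))
    where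
    absorb : doubleCoset H b (l ⁻¹ ∙ b ∙ (l ⁻¹) ⁻¹) → doubleCoset H (k ∙ a ∙ l ∙ b) (k ∙ z ∙ l)
    absorb (h₁ , h₂ , h₁∈H , h₂∈H , l⁻¹bl≈) =
      k ∙ h ∙ k ⁻¹ ∙ (k ∙ a ∙ l ∙ h₁ ∙ (k ∙ a ∙ l) ⁻¹) , h₂ ∙ (l ⁻¹ ∙ h′ ∙ l)
      , ∙-closed (conjugate-∈ k∈K h∈H)
                 (conjugate-∈ (∙∈K {k ∙ a} {l} (∙∈K {k} {a} k∈K a∈K) l∈K) h₁∈H)
      , ∙-closed h₂∈H (conjugate⁻¹-∈ l∈K h′∈H)
      , (begin
        k ∙ z ∙ l                                                                ≈⟨ ∙-congʳ (∙-congˡ z≈) ⟩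
        k ∙ (h ∙ (a ∙ b) ∙ h′) ∙ l
          ≈⟨ solve 6 (λ k l a b h h′ → k ⊕ (h ⊕ (a ⊕ b) ⊕ h′) ⊕ l ⊜
               k ⊕ h ⊕ a ⊕ l ⊕ (⊝ l ⊕ b ⊕ ⊝ (⊝ l)) ⊕ (⊝ l ⊕ h′ ⊕ l)) refl k l a b h h′ ⟩
        k ∙ h ∙ a ∙ l ∙ (l ⁻¹ ∙ b ∙ (l ⁻¹) ⁻¹) ∙ (l ⁻¹ ∙ h′ ∙ l)                 ≈⟨ ∙-congʳ (∙-congˡ l⁻¹bl≈) ⟩
        k ∙ h ∙ a ∙ l ∙ (h₁ ∙ b ∙ h₂) ∙ (l ⁻¹ ∙ h′ ∙ l)
          ≈⟨ solve 8 (λ k l a b h h′ h₁ h₂ → k ⊕ h ⊕ a ⊕ l ⊕ (h₁ ⊕ b ⊕ h₂) ⊕ (⊝ l ⊕ h′ ⊕ l) ⊜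
               k ⊕ h ⊕ ⊝ k ⊕ (k ⊕ a ⊕ l ⊕ h₁ ⊕ ⊝ (k ⊕ a ⊕ l)) ⊕ (k ⊕ a ⊕ l ⊕ b) ⊕ (h₂ ⊕ (⊝ l ⊕ h′ ⊕ l)))
               refl k l a b h h′ h₁ h₂ ⟩
        k ∙ h ∙ k ⁻¹ ∙ (k ∙ a ∙ l ∙ h₁ ∙ (k ∙ a ∙ l) ⁻¹) ∙ (k ∙ a ∙ l ∙ b) ∙ (h₂ ∙ (l ⁻¹ ∙ h′ ∙ l)) ∎)
      where open ≈-Reasoning setoid

  -- Inverting `z` leaves `b ⁻¹`, which H3 puts back into the double coset of `b`, between two
  -- elements of `K`. In Γ the factors from `H` disappear and `a ⁻¹` remains.
  Class-⁻¹ : ∀ {a z} → Class a z → Class (a Γ.⁻¹) (z ⁻¹)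
  Class-⁻¹ {a , a∈K} {z} (h , h′ , h∈H , h′∈H , z≈) = doubleCoset-resp
    (trans (solve 4 (λ a b h h′ → ⊝ h′ ⊕ ⊝ b ⊕ (⊝ a ⊕ ⊝ h) ⊜ ⊝ (h ⊕ (a ⊕ b) ⊕ h′)) refl a b h h′) (⁻¹-cong (sym z≈)))
    (Class-resp {k Γ.∙ Γ.ε Γ.∙ l} {(a , a∈K) Γ.⁻¹} (mk~ (respects
        (solve 3 (λ a h h′ → h ⊕ (a ⊕ h′ ⊕ ⊝ a) ⊜ ⊝ (⊝ h′ ⊕ e ⊕ (⊝ a ⊕ ⊝ h)) ⊕ ⊝ a) refl a h h′)
        (∙-closed h∈H (conjugate-∈ a∈K h′∈H))))
      (Class-act k l {Γ.ε} (proj₁ Class-ε b⁻¹-class)))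
    where
    k l : Γ.Carrier
    k = h′ ⁻¹ , H⊆K (⁻¹-closed h′∈H)
    l = (a , a∈K) Γ.⁻¹ Γ.∙ (h ⁻¹ , H⊆K (⁻¹-closed h∈H))

  -- Multiplying by `a′ ⁻¹` puts `a′ ⁻¹ ∙ a ∙ b` into the double coset of `b`, where H5 applies.
  Class-unique : ∀ {a a′ z} → Class a z → Class a′ z → a Γ.≈ a′
  Class-unique {a} {a′} {z} p q = Γ.sym (mk~ (H5 (proj₂ (a′ Γ.⁻¹ Γ.∙ a)) (proj₂ Class-ε a′⁻¹ab)))
    where
    a′⁻¹ab : Class Γ.ε (proj₁ (a′ Γ.⁻¹ Γ.∙ a) ∙ b)
    a′⁻¹ab = Class-resp {a′ Γ.⁻¹ Γ.∙ a′ Γ.∙ Γ.ε} (Γ.trans (Γ.identityʳ _) (Γ.inverseˡ a′))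
      (doubleCoset-resp (solve 3 (λ a a′ b → ⊝ a′ ⊕ (a ⊕ b) ⊕ e ⊜ ⊝ a′ ⊕ a ⊕ b) refl (proj₁ a) (proj₁ a′) b)
        (Class-act (a′ Γ.⁻¹) Γ.ε {a′} (doubleCoset-trans q (doubleCoset-sym p))))

  Class⇒∉K : ∀ {a z} → Class a z → ¬ K.Member z
  Class⇒∉K {a , a∈K} {z} (h , h′ , h∈H , h′∈H , z≈) z∈K = b∉K (K.respects
    (trans (∙-congʳ (∙-congˡ z≈)) (solve 4 (λ a b h h′ → ⊝ (h ⊕ a) ⊕ (h ⊕ (a ⊕ b) ⊕ h′) ⊕ ⊝ h′ ⊜ b) refl a b h h′))
    (∙∈K {(h ∙ a) ⁻¹ ∙ z} {h′ ⁻¹}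
      (∙∈K {(h ∙ a) ⁻¹} {z} (⁻¹∈K {h ∙ a} (∙∈K {h} {a} (H⊆K h∈H) a∈K)) z∈K)
      (⁻¹∈K {h′} (H⊆K h′∈H))))

  -- Double transitivity gives G = K ∪ KbK.
  Class-exists : ∀ z → ¬ K.Member z → ∃ λ a → Class a z
  Class-exists z z∉K with H1 ε b ε z (b∉K ∘ K.respects ε\\) (z∉K ∘ K.respects ε\\)
    where
    ε\\ : ∀ {x} → ε ⁻¹ ∙ x ≈ x
    ε\\ {x} = solve 1 (λ x → ⊝ e ⊕ x ⊜ x) refl x
  ... | g , gε~ε , gb~z = k Γ.∙ Γ.ε Γ.∙ l , doubleCoset-resp
      (solve 3 (λ g b z → g ⊕ b ⊕ (⊝ (g ⊕ b) ⊕ z) ⊜ z) refl g b z)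
      (Class-act k l {Γ.ε} (proj₁ Class-ε (doubleCoset-refl b)))
    where
    k l : Γ.Carrier
    k = g , K.respects (solve 1 (λ g → ⊝ (⊝ (g ⊕ e) ⊕ e) ⊜ g) refl g) (⁻¹∈K {(g ∙ ε) ⁻¹ ∙ ε} gε~ε)
    l = (g ∙ b) ⁻¹ ∙ z , gb~z

  -- Elements of `K` normalize `H`, so their double cosets are single cosets, that is, elements of
  -- Γ.
  doubleCoset-in-K : ∀ {a c : Γ.Carrier} → doubleCoset H (proj₁ a) (proj₁ c) ⇔ a Γ.≈ c
  doubleCoset-in-K {a , a∈K} {c , c∈K} = mk⇔
    (λ (h , h′ , h∈H , h′∈H , c≈) → mk~ (respects
      (trans (solve 3 (λ a h h′ → ⊝ a ⊕ h ⊕ a ⊕ h′ ⊜ ⊝ a ⊕ (h ⊕ a ⊕ h′)) refl a h h′) (∙-congˡ (sym c≈)))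
      (∙-closed (conjugate⁻¹-∈ a∈K h∈H) h′∈H)))
    (λ (mk~ p) → ε , a ⁻¹ ∙ c , ε-closed , p , solve 2 (λ a c → c ⊜ e ⊕ a ⊕ (⊝ a ⊕ c)) refl a c)

  doubleCoset-∈K : ∀ (a : Γ.Carrier) {z} → doubleCoset H (proj₁ a) z → K.Member z
  doubleCoset-∈K (a , a∈K) (h , h′ , h∈H , h′∈H , z≈) = K.respects (sym z≈)
    (∙∈K {h ∙ a} {h′} (∙∈K {h} {a} (H⊆K h∈H) a∈K) (H⊆K h′∈H))

  -- With only two cosets of K, both b and b⁻¹ normalize K, and then H5 lets b normalize H.
  ¬K-normalized : ¬ (∀ {c k} → ¬ K.Member c → K.Member k → K.Member (c ∙ k ∙ c ⁻¹))
  ¬K-normalized K-normalized = b∉K (∈K-intro b-conjugates b⁻¹-conjugates)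
    where
    b-conjugates : ∀ {h} → Member h → Member (b ∙ h ∙ b ⁻¹)
    b-conjugates {h} h∈H = H5 (K-normalized b∉K (H⊆K h∈H))
      (ε , h , ε-closed , h∈H , solve 2 (λ b h → b ⊕ h ⊕ ⊝ b ⊕ b ⊜ e ⊕ b ⊕ h) refl b h)
    b⁻¹-conjugates : ∀ {h} → Member h → Member (b ⁻¹ ∙ h ∙ b)
    b⁻¹-conjugates {h} h∈H with b⁻¹-class
    ... | h₁ , h₂ , h₁∈H , h₂∈H , b⁻¹≈ = respects
      (solve 2 (λ a h₁ → a ⊕ h₁ ⊕ ⊝ h₁ ⊜ a) refl a h₁) (∙-closed ah₁∈H (⁻¹-closed h₁∈H))
      where
      a = b ⁻¹ ∙ h ∙ b
      a∈K : K.Member a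
      a∈K = K.respects (solve 2 (λ b h → ⊝ b ⊕ h ⊕ ⊝ (⊝ b) ⊜ ⊝ b ⊕ h ⊕ b) refl b h)
        (K-normalized (λ b⁻¹∈K → b∉K (K.respects (solve 1 (λ b → ⊝ (⊝ b) ⊜ b) refl b) (⁻¹∈K {b ⁻¹} b⁻¹∈K)))
          (H⊆K h∈H))
      ah₁∈H : Member (a ∙ h₁)
      ah₁∈H = H5 (∙∈K {a} {h₁} a∈K (H⊆K h₁∈H)) (doubleCoset-trans b⁻¹-class
        (ε , h ∙ h₂ ⁻¹ , ε-closed , ∙-closed h∈H (⁻¹-closed h₂∈H) , (begin
          a ∙ h₁ ∙ b                          ≈⟨ solve 4 (λ a h₁ b h₂ → a ⊕ h₁ ⊕ b ⊜ a ⊕ (h₁ ⊕ b ⊕ h₂) ⊕ ⊝ h₂) refl a h₁ b h₂ ⟩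
          a ∙ (h₁ ∙ b ∙ h₂) ∙ h₂ ⁻¹           ≈⟨ ∙-congʳ (∙-congˡ b⁻¹≈) ⟨
          a ∙ b ⁻¹ ∙ h₂ ⁻¹                    ≈⟨ solve 3 (λ b h h₂ → ⊝ b ⊕ h ⊕ b ⊕ ⊝ b ⊕ ⊝ h₂ ⊜ e ⊕ ⊝ b ⊕ (h ⊕ ⊝ h₂)) refl b h h₂ ⟩
          ε ∙ b ⁻¹ ∙ (h ∙ h₂ ⁻¹)              ∎)))
        where open ≈-Reasoning setoid

-- Decidability of `K`, finiteness of `G / K` and `K / H`.

module HigmanFiniteness {G : Group 0ℓ 0ℓ} (finite : Finite (Group.setoid G)) {H : Subgroup G}
                        (H? : Decidable (Subgroup.Member H)) (higman : HigmanPair G H) where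
  open Group G
  open Subgroup H using (Member; respects; ε-closed; ∙-closed; ⁻¹-closed)
  open FreeGroupSolver G
  open Cosets H
  open Normalizer H
  open HigmanClasses higman
  open Finiteness finite using (enumerate)

  index : Carrier → Fin (proj₁ finite)
  index = Inverse.to (proj₂ finite)

  enumerate-index : ∀ x → enumerate (index x) ≈ x
  enumerate-index = Inverse.strictlyInverseʳ (proj₂ finite)

  K? : Decidable K.Member
  K? g = map′
    (λ all → ∈K-intro (λ {h} h∈H → respects (∙-congʳ (∙-congˡ (enumerate-index h))) (proj₁ (all (index h)) (∈H h∈H)))
                      (λ {h} h∈H → respects (∙-congʳ (∙-congˡ (enumerate-index h))) (proj₂ (all (index h)) (∈H h∈H))))
    (λ g∈K i → conjugate-∈ g∈K , conjugate⁻¹-∈ g∈K)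
    (Fin.all? λ i → (H? (enumerate i) →-dec H? (g ∙ enumerate i ∙ g ⁻¹)) ×-dec
                    (H? (enumerate i) →-dec H? (g ⁻¹ ∙ enumerate i ∙ g)))
    where
    ∈H : ∀ {h} → Member h → Member (enumerate (index h))
    ∈H {h} = respects (sym (enumerate-index h))

  finiteᴷ : Finite (leftCosets (normalizer H))
  finiteᴷ = covered⇒finite _ (λ x y → K? (x ⁻¹ ∙ y)) enumerate λ x → index x
    , K.respects (trans (sym (inverseˡ x)) (∙-congˡ (sym (enumerate-index x)))) K.ε-closed

  finiteᴳ : Finite Γ.setoid
  finiteᴳ = covered⇒finite Γ.setoid (λ x y → map′ mk~ _~_.member (H? (proj₁ x ⁻¹ ∙ proj₁ y)))
    (λ i → toΓ (enumerate i)) (λ x → index (proj₁ x) , toΓ-≈ (enumerate (index (proj₁ x))) x (enumerate-index (proj₁ x)))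
    where
    toΓ : Carrier → Γ.Carrier
    toΓ x with K? x
    ... | yes x∈K = x , x∈K
    -- A default outside `K`; the repetitions of `ε` that it causes are harmless in a covering list.
    ... | no _    = Γ.ε
    toΓ-≈ : ∀ x a → x ≈ proj₁ a → a Γ.≈ toΓ x
    toΓ-≈ x a x≈a with K? x
    ... | yes x∈K = ≈⇒~ (sym x≈a)
    ... | no x∉K  = contradiction (K.respects (sym x≈a) (proj₂ a)) x∉K

-- The roux of a Higman pair.

module RouxFromHigman {G : Group 0ℓ 0ℓ} (finite : Finite (Group.setoid G)) {H : Subgroup G}
                      (H? : Decidable (Subgroup.Member H)) (higman : HigmanPair G H)
                      (K? : Decidable (Subgroup.Member (normalizer H)))
                      (finiteᴷ : Finite (leftCosets (normalizer H)))
                      (finiteᴳ : Finite (AbelianGroup.setoid (HigmanClasses.Γ higman))) where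
  open Group G
  open Subgroup H using (Member; respects; ε-closed; ∙-closed; ⁻¹-closed)
  open FreeGroupSolver G
  open Cosets H
  open Normalizer H
  open HigmanPair higman using (b; b∉K)
  open HigmanClasses higman
  module ≈ᴷ = Setoid (leftCosets (normalizer H))

  n : ℕ
  n = proj₁ finiteᴷ

  module cosetK = Inverse (proj₂ finiteᴷ)

  r : Fin n → Carrier
  r = cosetK.from

  r-distinct : ∀ {i j} → i ≢ j → ¬ (r i ≈ᴷ.≈ r j)
  r-distinct {i} {j} i≢j p = i≢j (≡.trans (≡.sym (cosetK.strictlyInverseˡ i))
    (≡.trans (cosetK.to-cong {r i} {r j} p) (cosetK.strictlyInverseˡ j)))

  to-distinct : ∀ x y → ¬ (x ≈ᴷ.≈ y) → cosetK.to x ≢ cosetK.to y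
  to-distinct x y x≉y p = x≉y (≈ᴷ.trans {x} {r (cosetK.to y)} {y}
    (≈ᴷ.sym {r (cosetK.to y)} {x} (cosetK.inverseʳ (≡.sym p))) (cosetK.strictlyInverseʳ y))

  -- If `c ∙ k ∙ c ⁻¹` were outside `K`, then `ε`, `c` and `c ∙ k ∙ c ⁻¹` would lie in three cosets
  -- of `K`. With only two cosets, `K` would be normalized, contrary to `¬K-normalized`.
  n≢2 : n ≢ 2
  n≢2 n≡2 = ¬K-normalized K-normalized
    where
    K-normalized : ∀ {c k} → ¬ K.Member c → K.Member k → K.Member (c ∙ k ∙ c ⁻¹)
    K-normalized {c} {k} c∉K k∈K with K? (c ∙ k ∙ c ⁻¹)
    ... | yes p = p
    ... | no ckc⁻¹∉K = contradiction n≡2 (Fin2-pigeonhole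
      (to-distinct ε c (c∉K ∘ K.respects ε\\))
      (to-distinct ε (c ∙ k ∙ c ⁻¹) (ckc⁻¹∉K ∘ K.respects ε\\))
      (to-distinct c (c ∙ k ∙ c ⁻¹) λ p → c∉K (K.respects
        (solve 2 (λ c k → ⊝ (⊝ c ⊕ (c ⊕ k ⊕ ⊝ c)) ⊕ k ⊜ c) refl c k)
        (∙∈K {(c ⁻¹ ∙ (c ∙ k ∙ c ⁻¹)) ⁻¹} {k} (⁻¹∈K {c ⁻¹ ∙ (c ∙ k ∙ c ⁻¹)} p) k∈K))))
      where
      ε\\ : ∀ {x} → ε ⁻¹ ∙ x ≈ x
      ε\\ {x} = solve 1 (λ x → ⊝ e ⊕ x ⊜ x) refl x

  open Finiteness finiteᴳ using () renaming (_≟_ to _≟ᴳ_)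
  open GroupRing Γ finiteᴳ
  open RouxEntries Γ finiteᴳ

  β : Fin n → Fin n → Γ.Carrier
  β i j with i Fin.≟ j
  -- A default: `B` is zero here, and `r i ⁻¹ ∙ r i` lies in no `Class`.
  ... | yes _  = Γ.ε
  ... | no i≢j = proj₁ (Class-exists (r i ⁻¹ ∙ r j) (r-distinct i≢j))

  β-class : ∀ {i j} → i ≢ j → Class (β i j) (r i ⁻¹ ∙ r j)
  β-class {i} {j} i≢j with i Fin.≟ j
  ... | yes i≡j = contradiction i≡j i≢j
  ... | no i≢j′ = proj₂ (Class-exists (r i ⁻¹ ∙ r j) (r-distinct i≢j′))

  -- Colours are read from the quotient `r j ⁻¹ ∙ r i`, whereas `β i j` records its inverse.
  -- Compared with `β-class` for `j`, `i`, this is R3.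
  β⁻¹-class : ∀ {i j} → i ≢ j → Class (β i j Γ.⁻¹) (r j ⁻¹ ∙ r i)
  β⁻¹-class {i} {j} i≢j = doubleCoset-resp
    (solve 2 (λ x y → ⊝ (⊝ x ⊕ y) ⊜ ⊝ y ⊕ x) refl (r i) (r j)) (Class-⁻¹ {β i j} (β-class i≢j))

  B : Matrix n
  B i j = if does (i Fin.≟ j) then 𝟘 else ⟨ β i j ⟩

  entries : HasEntries B β
  entries = diagonal , off-diagonal
    where
    diagonal : ∀ i → B i i ≋ 𝟘
    diagonal i x with i Fin.≟ i
    ... | yes _  = ℂ.refl
    ... | no i≢i = contradiction ≡.refl i≢i
    off-diagonal : ∀ {i j} → i ≢ j → B i j ≋ ⟨ β i j ⟩
    off-diagonal {i} {j} i≢j x with i Fin.≟ j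
    ... | yes i≡j = contradiction i≡j i≢j
    ... | no _    = ℂ.refl

  open Colouring Γ β
  open Entries {B = B} β entries

  representative : Γ.Carrier ⊎ Γ.Carrier → Carrier
  representative (inj₁ g) = proj₁ g
  representative (inj₂ g) = proj₁ g ∙ b

  point : Point → Carrier
  point (i , k) = r i ∙ proj₁ k

  same-fibre : ∀ {i j} k l → K.Member (point (j , l) ⁻¹ ∙ point (i , k)) → i ≡ j
  same-fibre {i} {j} k l p with i Fin.≟ j
  ... | yes i≡j = i≡j
  ... | no i≢j = contradiction
    (K.respects (solve 4 (λ x y k l → l ⊕ (⊝ (y ⊕ l) ⊕ (x ⊕ k)) ⊕ ⊝ k ⊜ ⊝ y ⊕ x) refl (r i) (r j) (proj₁ k) (proj₁ l))
      (∙∈K {proj₁ l ∙ (point (j , l) ⁻¹ ∙ point (i , k))} {proj₁ k ⁻¹}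
        (∙∈K {proj₁ l} {point (j , l) ⁻¹ ∙ point (i , k)} (proj₂ l) p)
        (⁻¹∈K {proj₁ k} (proj₂ k))))
    (r-distinct (i≢j ∘ ≡.sym))

  -- The quotient of the points is `r j ⁻¹ ∙ r i` between the inverse of `l` and `k`. It lies in `K`
  -- for `i ≡ j`; otherwise `Class-act` puts it in the class of `g = l ⁻¹ ∙ β i j ⁻¹ ∙ k`.
  -- Uniqueness of classes and commutativity of Γ give the colour.
  doubleCoset⇔Colour : ∀ c p q → doubleCoset H (representative c) (point q ⁻¹ ∙ point p) ⇔ Colour c p q
  doubleCoset⇔Colour (inj₁ g) (i , k) (j , l) = mk⇔ forward backward
    where
    l⁻¹k≈ : r i ≈ r j → point (j , l) ⁻¹ ∙ point (i , k) ≈ proj₁ (l Γ.⁻¹ Γ.∙ k)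
    l⁻¹k≈ rᵢ≈rⱼ = trans (∙-congˡ (∙-congʳ rᵢ≈rⱼ))
      (solve 3 (λ x k l → ⊝ (x ⊕ l) ⊕ (x ⊕ k) ⊜ ⊝ l ⊕ k) refl (r j) (proj₁ k) (proj₁ l))
    forward : doubleCoset H (proj₁ g) (point (j , l) ⁻¹ ∙ point (i , k)) → Colour (inj₁ g) (i , k) (j , l)
    forward p with same-fibre k l (doubleCoset-∈K g p)
    ... | ≡.refl = ≡.refl , Γ.trans (Γ.sym (Γ.\\-leftDividesˡ l k)) (Γ.trans
      (Γ.∙-congˡ (Γ.sym (Equivalence.to (doubleCoset-in-K {g} {l Γ.⁻¹ Γ.∙ k}) (doubleCoset-resp (l⁻¹k≈ refl) p))))
      (Γ.comm l g))
    backward : Colour (inj₁ g) (i , k) (j , l) → doubleCoset H (proj₁ g) (point (j , l) ⁻¹ ∙ point (i , k))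
    backward (≡.refl , k≈gl) = doubleCoset-resp (sym (l⁻¹k≈ refl)) (Equivalence.from (doubleCoset-in-K {g} {l Γ.⁻¹ Γ.∙ k})
      (Γ.trans (Γ.sym (Γ.\\-leftDividesʳ l g)) (Γ.∙-congˡ (Γ.trans (Γ.comm l g) (Γ.sym k≈gl)))))
  doubleCoset⇔Colour (inj₂ g) (i , k) (j , l) = mk⇔ forward backward
    where
    class : i ≢ j → Class (l Γ.⁻¹ Γ.∙ β i j Γ.⁻¹ Γ.∙ k) (point (j , l) ⁻¹ ∙ point (i , k))
    class i≢j = doubleCoset-resp
      (solve 4 (λ x y k l → ⊝ l ⊕ (⊝ y ⊕ x) ⊕ k ⊜ ⊝ (y ⊕ l) ⊕ (x ⊕ k)) refl (r i) (r j) (proj₁ k) (proj₁ l))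
      (Class-act (l Γ.⁻¹) k {β i j Γ.⁻¹} (β⁻¹-class i≢j))
    gβl≈ : g Γ.∙ β i j Γ.∙ l Γ.≈ (β i j Γ.∙ l) Γ.∙ g
    gβl≈ = Γ.trans (Γ.assoc g (β i j) l) (Γ.comm g (β i j Γ.∙ l))
    l⁻¹β⁻¹k≈ : l Γ.⁻¹ Γ.∙ β i j Γ.⁻¹ Γ.∙ k Γ.≈ (β i j Γ.∙ l) Γ.⁻¹ Γ.∙ k
    l⁻¹β⁻¹k≈ = Γ.∙-congʳ (Γ.sym (Γ.⁻¹-anti-homo-∙ (β i j) l))
    forward : doubleCoset H (proj₁ g ∙ b) (point (j , l) ⁻¹ ∙ point (i , k)) → Colour (inj₂ g) (i , k) (j , l)
    forward p = i≢j , Γ.trans (Γ.sym (Γ.\\-leftDividesˡ (β i j Γ.∙ l) k))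
      (Γ.trans (Γ.∙-congˡ (Γ.sym (Γ.trans (Class-unique {g} p (class i≢j)) l⁻¹β⁻¹k≈))) (Γ.sym gβl≈))
      where
      i≢j : i ≢ j
      i≢j ≡.refl = Class⇒∉K {g} p (K.respects
        (solve 3 (λ x k l → ⊝ l ⊕ k ⊜ ⊝ (x ⊕ l) ⊕ (x ⊕ k)) refl (r i) (proj₁ k) (proj₁ l))
        (proj₂ (l Γ.⁻¹ Γ.∙ k)))
    backward : Colour (inj₂ g) (i , k) (j , l) → doubleCoset H (proj₁ g ∙ b) (point (j , l) ⁻¹ ∙ point (i , k))
    backward (i≢j , k≈) = Class-resp {l Γ.⁻¹ Γ.∙ β i j Γ.⁻¹ Γ.∙ k} {g}
      (Γ.trans l⁻¹β⁻¹k≈ (Γ.trans (Γ.∙-congˡ (Γ.trans k≈ gβl≈)) (Γ.\\-leftDividesʳ (β i j Γ.∙ l) g)))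
      (class i≢j)

  ⟨⟩-cong : ∀ {g h} → g Γ.≈ h → ⟨ g ⟩ ≋ ⟨ h ⟩
  ⟨⟩-cong {g} {h} g≈h x = indicator-cong (Γ.trans (Γ.sym g≈h)) (Γ.trans g≈h) (g ≟ᴳ x) (h ≟ᴳ x)

  B-inverse : ∀ {i j} → i ≢ j → ∀ {g} → B i j ≋ ⟨ g ⟩ → B j i ≋ ⟨ g Γ.⁻¹ ⟩
  B-inverse {i} {j} i≢j {g} B≋g x = ℂ.trans (proj₂ entries (i≢j ∘ ≡.sym) x) (⟨⟩-cong
    (Γ.trans (Class-unique {β j i} (β-class (i≢j ∘ ≡.sym)) (β⁻¹-class i≢j))
      (Γ.⁻¹-cong (⟨⟩-injective λ y → ℂ.trans (ℂ.sym (proj₂ entries i≢j y)) (B≋g y)))) x)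

  σ : Inverse (leftCosets H) (≡.setoid (Fin n) ×ₛ Γ.setoid)
  σ = record
    { to        = coordinates
    ; from      = point
    ; to-cong   = λ {x} {y} p → coordinates-cong x y p
    ; from-cong = λ {p} {q} → point-cong p q
    ; inverse   =
        (λ {p} {x} x≈ → Setoid.trans (≡.setoid (Fin n) ×ₛ Γ.setoid) {coordinates x} {coordinates (point p)} {p}
          (coordinates-cong x (point p) x≈) (coordinates-point p)) ,
        (λ {x} {p} p≈ → ≈ᴴ.trans {point p} {point (coordinates x)} {x} (point-cong p (coordinates x) p≈)
          (respects (sym (trans (∙-congʳ (⁻¹-cong (point-coordinates x))) (inverseˡ x))) ε-closed))
    }
    where
    coordinates : Carrier → Point
    coordinates x = cosetK.to x , r (cosetK.to x) ⁻¹ ∙ x , cosetK.strictlyInverseʳ x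
    point-coordinates : ∀ x → point (coordinates x) ≈ x
    point-coordinates x = solve 2 (λ r x → r ⊕ (⊝ r ⊕ x) ⊜ x) refl (r (cosetK.to x)) x
    coordinates-≈ : ∀ {x y i j} (k : K.Member (r i ⁻¹ ∙ x)) (l : K.Member (r j ⁻¹ ∙ y)) → i ≡ j → x ≈ᴴ.≈ y →
                    (r i ⁻¹ ∙ x , k) Γ.≈ (r j ⁻¹ ∙ y , l)
    coordinates-≈ {x} {y} {i} k l ≡.refl p = mk~ (respects
      (solve 3 (λ r x y → ⊝ x ⊕ y ⊜ ⊝ (⊝ r ⊕ x) ⊕ (⊝ r ⊕ y)) refl (r i) x y) p)
    coordinates-cong : ∀ x y → x ≈ᴴ.≈ y → proj₁ (coordinates x) ≡ proj₁ (coordinates y) × proj₂ (coordinates x) Γ.≈ proj₂ (coordinates y)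
    coordinates-cong x y p = x≡y , coordinates-≈ _ _ x≡y p
      where
      x≡y : cosetK.to x ≡ cosetK.to y
      x≡y = cosetK.to-cong {x} {y} (H⊆K p)
    point-cong : ∀ p q → proj₁ p ≡ proj₁ q × proj₂ p Γ.≈ proj₂ q → point p ≈ᴴ.≈ point q
    point-cong (i , k) (_ , l) (≡.refl , mk~ p) = respects
      (solve 3 (λ x k l → ⊝ k ⊕ l ⊜ ⊝ (x ⊕ k) ⊕ (x ⊕ l)) refl (r i) (proj₁ k) (proj₁ l)) p
    coordinates-point : ∀ p → proj₁ (coordinates (point p)) ≡ proj₁ p × proj₂ (coordinates (point p)) Γ.≈ proj₂ p
    coordinates-point (i , k) = i≡ , ≈⇒~ (trans (∙-congʳ (⁻¹-cong (reflexive (≡.cong r i≡))))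
      (solve 2 (λ r k → ⊝ r ⊕ (r ⊕ k) ⊜ k) refl (r i) (proj₁ k)))
      where
      i≡ : cosetK.to (r i ∙ proj₁ k) ≡ i
      i≡ = cosetK.inverseˡ {i} {r i ∙ proj₁ k} (K.respects
        (solve 2 (λ r k → ⊝ k ⊜ ⊝ (r ⊕ k) ⊕ r) refl (r i) (proj₁ k)) (⁻¹∈K {proj₁ k} (proj₂ k)))

  -- The span as a Hecke algebra, closed under convolution.

  doubleCosetᴴ? : ∀ a z → Dec (doubleCoset H a z)
  doubleCosetᴴ? = doubleCoset? G finite H H?

  DoubleCosetInvariant : (Carrier → ℂ.Carrier) → Set
  DoubleCosetInvariant F = ∀ {x y} → doubleCoset H x y → F x ℂ.≈ F y

  -- F is the function on H \ G / H to which M corresponds when the algebra spanned by the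
  -- scheme is identified with the Hecke algebra of (G , H).
  Represents : (Carrier → ℂ.Carrier) → Matrix n → Set
  Represents F M = ∀ i j {k l x} → x Γ.∙ l Γ.≈ k → Func.to (M i j) x ℂ.≈ F (point (j , l) ⁻¹ ∙ point (i , k))

  classMatrix-represented : ∀ c → Represents (λ z → indicator (doubleCosetᴴ? (representative c) z)) (classMatrix c)
  classMatrix-represented c i j {k} {l} xl≈k = ℂ.trans (entry c xl≈k)
    (ℂ.sym (indicator-⇔ (doubleCosetᴴ? _ _) (Colour? c (i , k) (j , l)) (doubleCoset⇔Colour c (i , k) (j , l))))

  combination : (c d : Γ.Carrier → ℂ.Carrier) → Carrier → Γ.Carrier → ℂ.Carrier
  combination c d z g = c g ℂ.* indicator (doubleCosetᴴ? (proj₁ g) z) ℂ.+ d g ℂ.* indicator (doubleCosetᴴ? (proj₁ g ∙ b) z)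

  combination-represented : ∀ c d {i j k l x} → x Γ.∙ l Γ.≈ k →
    ∑[ (λ g → c g ℂ.* Func.to ((g · 𝟙) i j) x ℂ.+ d g ℂ.* Func.to ((g · B) i j) x) ] ℂ.≈
    ∑[ combination c d (point (j , l) ⁻¹ ∙ point (i , k)) ]
  combination-represented c d {i} {j} xl≈k = ∑-cong λ g → ℂ.+-cong
    (ℂ.*-congˡ {c g} (classMatrix-represented (inj₁ g) i j xl≈k))
    (ℂ.*-congˡ {d g} (classMatrix-represented (inj₂ g) i j xl≈k))

  inSpan⇒represented : ∀ {M} → InSpan B M → ∃ λ F → DoubleCosetInvariant F × Represents F M
  inSpan⇒represented {M} (c , d , M≈) = (λ z → ∑[ combination c d z ]) , invariant , represents
    where
    invariant : DoubleCosetInvariant (λ z → ∑[ combination c d z ])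
    invariant {x} {y} xy = ∑-cong λ g → ℂ.+-cong
      (ℂ.*-congˡ {c g} (same (proj₁ g))) (ℂ.*-congˡ {d g} (same (proj₁ g ∙ b)))
      where
      same : ∀ a → indicator (doubleCosetᴴ? a x) ℂ.≈ indicator (doubleCosetᴴ? a y)
      same a = indicator-cong (λ p → doubleCoset-trans p xy) (λ p → doubleCoset-trans p (doubleCoset-sym xy))
        (doubleCosetᴴ? a x) (doubleCosetᴴ? a y)
    represents : Represents (λ z → ∑[ combination c d z ]) M
    represents i j {x = x} xl≈k = ℂ.trans (M≈ i j x) (combination-represented c d xl≈k)

  class-of : ∀ z → ∃ λ c → doubleCoset H (representative c) z
  class-of z with K? z
  ... | yes z∈K = inj₁ (z , z∈K) , doubleCoset-refl z
  ... | no z∉K  = let a , p = Class-exists z z∉K in inj₂ a , p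

  -- Coefficients in `InSpan` are arbitrary functions on the carrier of Γ. Values of `F` at
  -- representatives make the summand respect equality in `K / H`, as `∑-unique` requires.
  combinationᶠ : ∀ {F} → DoubleCosetInvariant F → Carrier → Func Γ.setoid ℂ.setoid
  combinationᶠ {F} F-inv z = record
    { to   = combination (F ∘ proj₁) (λ g → F (proj₁ g ∙ b)) z
    ; cong = λ {x} {y} x≈y → ℂ.+-cong (term (Equivalence.from doubleCoset-in-K x≈y))
                                      (term (Class-resp {y} {x} (Γ.sym x≈y) (doubleCoset-refl (proj₁ y ∙ b))))
    }
    where
    term : ∀ {a a′} → doubleCoset H a a′ →
           F a ℂ.* indicator (doubleCosetᴴ? a z) ℂ.≈ F a′ ℂ.* indicator (doubleCosetᴴ? a′ z)
    term {a} {a′} aa′ = ℂ.*-cong (F-inv aa′) (indicator-cong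
      (doubleCoset-trans (doubleCoset-sym aa′)) (doubleCoset-trans aa′) (doubleCosetᴴ? a z) (doubleCosetᴴ? a′ z))

  -- `z` lies in exactly one double coset, so one summand survives, and only one of its two terms.
  expand : ∀ {F} → DoubleCosetInvariant F → ∀ z → ∑[ combination (F ∘ proj₁) (λ g → F (proj₁ g ∙ b)) z ] ℂ.≈ F z
  expand {F} F-inv z with class-of z
  ... | inj₁ y , yz = ℂ.trans (∑-unique summand y elsewhere) (ℂ.trans
      (ℂ.+-cong (ℂ.trans (ℂ.*-congˡ (indicator-true (doubleCosetᴴ? _ z) yz)) (ℂ.*-identityʳ _))
                (ℂ.trans (ℂ.*-congˡ (indicator-false (doubleCosetᴴ? _ z) λ p → Class⇒∉K {y} p (doubleCoset-∈K y yz))) (ℂ.zeroʳ _)))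
      (ℂ.trans (ℂ.+-identityʳ _) (F-inv yz)))
    where
    summand = combinationᶠ F-inv z
    elsewhere : ∀ x → ¬ (y Γ.≈ x) → Func.to summand x ℂ.≈ ℂ.0#
    elsewhere x y≉x = ℂ.trans (ℂ.+-cong
      (ℂ.trans (ℂ.*-congˡ (indicator-false (doubleCosetᴴ? _ z) λ p →
        y≉x (Equivalence.to doubleCoset-in-K (doubleCoset-trans yz (doubleCoset-sym p))))) (ℂ.zeroʳ _))
      (ℂ.trans (ℂ.*-congˡ (indicator-false (doubleCosetᴴ? _ z) λ p → Class⇒∉K {x} p (doubleCoset-∈K y yz))) (ℂ.zeroʳ _)))
      (ℂ.+-identityʳ _)
  ... | inj₂ y , yz = ℂ.trans (∑-unique summand y elsewhere) (ℂ.trans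
      (ℂ.+-cong (ℂ.trans (ℂ.*-congˡ (indicator-false (doubleCosetᴴ? _ z) λ p → Class⇒∉K {y} yz (doubleCoset-∈K y p))) (ℂ.zeroʳ _))
                (ℂ.trans (ℂ.*-congˡ (indicator-true (doubleCosetᴴ? _ z) yz)) (ℂ.*-identityʳ _)))
      (ℂ.trans (ℂ.+-identityˡ _) (F-inv yz)))
    where
    summand = combinationᶠ F-inv z
    elsewhere : ∀ x → ¬ (y Γ.≈ x) → Func.to summand x ℂ.≈ ℂ.0#
    elsewhere x y≉x = ℂ.trans (ℂ.+-cong
      (ℂ.trans (ℂ.*-congˡ (indicator-false (doubleCosetᴴ? _ z) λ p → Class⇒∉K {y} yz (doubleCoset-∈K x p))) (ℂ.zeroʳ _))
      (ℂ.trans (ℂ.*-congˡ (indicator-false (doubleCosetᴴ? _ z) λ p → y≉x (Class-unique {y} yz p))) (ℂ.zeroʳ _)))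
      (ℂ.+-identityʳ _)

  -- The coefficients are the values of `F` on the double cosets. Taking `l = ε` reads the group
  -- ring coefficient at `x`.
  represented⇒inSpan : ∀ {F M} → DoubleCosetInvariant F → Represents F M → InSpan B M
  represented⇒inSpan {F} {M} F-inv M≈ = F ∘ proj₁ , (λ g → F (proj₁ g ∙ b)) , λ i j x →
    ℂ.trans (M≈ i j (Γ.identityʳ x)) (ℂ.trans (ℂ.sym (expand F-inv _))
      (ℂ.sym (combination-represented (F ∘ proj₁) (λ g → F (proj₁ g ∙ b)) (Γ.identityʳ x))))

  cosetsH : Finite (leftCosets H)
  cosetsH = _ , Composition.inverse σ (proj₂ (×-finite (n , Identity.inverse _) finiteᴳ))

  ∑ᴴ : (Carrier → ℂ.Carrier) → ℂ.Carrier
  ∑ᴴ f = sum (λ q → f (Inverse.from (proj₂ cosetsH) q))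

  CosetFunction : Set
  CosetFunction = Func (leftCosets H) ℂ.setoid

  -- Oriented so that `from`, the direction used by enumerations, is multiplication by `g`.
  translation : Carrier → Inverse (leftCosets H) (leftCosets H)
  translation g = record
    { to        = g ⁻¹ ∙_
    ; from      = g ∙_
    ; to-cong   = λ {x} {y} → cong (g ⁻¹) {x} {y}
    ; from-cong = λ {x} {y} → cong g {x} {y}
    ; inverse   = (λ {x} {y} p → respects (solve 3 (λ g x y → ⊝ y ⊕ (g ⊕ x) ⊜ ⊝ (⊝ g ⊕ y) ⊕ x) refl g x y) p)
                , (λ {x} {y} p → respects (solve 3 (λ g x y → ⊝ y ⊕ (⊝ g ⊕ x) ⊜ ⊝ (g ⊕ y) ⊕ x) refl g x y) p)
    }
    where
    cong : ∀ g {x y} → x ≈ᴴ.≈ y → (g ∙ x) ≈ᴴ.≈ (g ∙ y)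
    cong g {x} {y} p = respects (solve 3 (λ g x y → ⊝ x ⊕ y ⊜ ⊝ (g ⊕ x) ⊕ (g ⊕ y)) refl g x y) p

  ∑ᴴ-translate : ∀ (f : CosetFunction) g → ∑ᴴ (Func.to f) ℂ.≈ ∑ᴴ (λ w → Func.to f (g ∙ w))
  ∑ᴴ-translate f g = sum-reindex (proj₂ cosetsH) (Composition.inverse (translation g) (proj₂ cosetsH)) f

  ∑ᴴ-cong : ∀ {f g : Carrier → ℂ.Carrier} → (∀ w → f w ℂ.≈ g w) → ∑ᴴ f ℂ.≈ ∑ᴴ g
  ∑ᴴ-cong f≈g = sum-cong-≋ λ q → f≈g (Inverse.from (proj₂ cosetsH) q)

  -- Its `from` is the substitution that makes the summation index of a group ring product the
  -- Γ-coordinate of a middle point.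
  reflection : Γ.Carrier → Inverse Γ.setoid Γ.setoid
  reflection k = record
    { to        = λ x → k Γ.∙ x Γ.⁻¹
    ; from      = λ x → x Γ.⁻¹ Γ.∙ k
    ; to-cong   = λ p → Γ.∙-congˡ (Γ.⁻¹-cong p)
    ; from-cong = λ p → Γ.∙-congʳ (Γ.⁻¹-cong p)
    ; inverse   = (λ {x} p → Γ.trans (Γ.∙-congˡ (Γ.⁻¹-cong p)) (cancel k x))
                , (λ {x} p → Γ.trans (Γ.∙-congʳ (Γ.⁻¹-cong p)) (cancel′ k x))
    }
    where
    cancel : ∀ k x → k Γ.∙ (x Γ.⁻¹ Γ.∙ k) Γ.⁻¹ Γ.≈ x
    cancel (k , _) (x , _) = ≈⇒~ (solve 2 (λ k x → k ⊕ ⊝ (⊝ x ⊕ k) ⊜ x) refl k x)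
    cancel′ : ∀ k x → (k Γ.∙ x Γ.⁻¹) Γ.⁻¹ Γ.∙ k Γ.≈ x
    cancel′ (k , _) (x , _) = ≈⇒~ (solve 2 (λ k x → ⊝ (k ⊕ ⊝ x) ⊕ k ⊜ x) refl k x)

  -- For fixed `k` the points with coordinates `m` and `y ⁻¹ ∙ k` run once through `G / H`. The sums
  -- of the matrix product and of the group ring product thereby merge.
  ∑-points : ∀ (f : CosetFunction) k → sum (λ m → ∑[ (λ y → Func.to f (point (m , y Γ.⁻¹ Γ.∙ k))) ]) ℂ.≈ ∑ᴴ (Func.to f)
  ∑-points f k = ℂ.trans (ℂ.sym (ℂ.trans (sum-combine n _) (sum-cong-≋ λ m → sum-cong-≋ λ y → on-pair m y)))
    (sum-reindex reflected (proj₂ cosetsH) f)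
    where
    reflected : Inverse (leftCosets H) (≡.setoid (Fin _))
    reflected = Composition.inverse σ (Composition.inverse (Identity.inverse _ ×-inverse reflection k)
      (proj₂ (×-finite (n , Identity.inverse _) finiteᴳ)))
    value : Fin n × Fin (proj₁ finiteᴳ) → ℂ.Carrier
    value (m , y) = Func.to f (point (m , Inverse.from (proj₂ finiteᴳ) y Γ.⁻¹ Γ.∙ k))
    on-pair : ∀ m y → Func.to f (Inverse.from reflected (combine m y)) ℂ.≈ value (m , y)
    on-pair m y = ℂ.reflexive (≡.cong value (Fin.remQuot-combine m y))

  infixl 7 _⋆_
  -- Convolution over `G / H` with the factors in reverse order, `z ≈ (z ∙ w) ∙ w ⁻¹`, since the
  -- entry at points `p`, `q` is read at `q ⁻¹ ∙ p`.
  _⋆_ : (Carrier → ℂ.Carrier) → (Carrier → ℂ.Carrier) → Carrier → ℂ.Carrier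
  (F ⋆ F′) z = ∑ᴴ (λ w → F (w ⁻¹) ℂ.* F′ (z ∙ w))

  module _ {F F′ : Carrier → ℂ.Carrier} (F-inv : DoubleCosetInvariant F) (F′-inv : DoubleCosetInvariant F′) where

    -- The contribution of the middle point `w` to a matrix product. It depends only on the coset of
    -- `w`, as `F` is invariant on the left and `F′` on the right.
    correlate : Carrier → Carrier → CosetFunction
    correlate u v = record
      { to   = λ w → F (w ⁻¹ ∙ u) ℂ.* F′ (v ∙ w)
      ; cong = λ {x} {y} p → ℂ.*-cong
          (F-inv ((x ⁻¹ ∙ y) ⁻¹ , ε , ⁻¹-closed p , ε-closed
                 , solve 3 (λ u x y → ⊝ y ⊕ u ⊜ ⊝ (⊝ x ⊕ y) ⊕ (⊝ x ⊕ u) ⊕ e) refl u x y))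
          (F′-inv (ε , x ⁻¹ ∙ y , ε-closed , p
                  , solve 3 (λ v x y → v ⊕ y ⊜ e ⊕ (v ⊕ x) ⊕ (⊝ x ⊕ y)) refl v x y))
      }

    invariant-≈ : ∀ {F} → DoubleCosetInvariant F → ∀ {x y} → x ≈ y → F x ℂ.≈ F y
    invariant-≈ inv {x} x≈y = inv (doubleCoset-resp x≈y (doubleCoset-refl x))

    -- The substitution of `u ∙ w` for `w` leaves a dependence on `v ∙ u` alone.
    ⋆-translate : ∀ u v → ∑ᴴ (Func.to (correlate u v)) ℂ.≈ (F ⋆ F′) (v ∙ u)
    ⋆-translate u v = ℂ.trans (∑ᴴ-translate (correlate u v) u) (∑ᴴ-cong λ w → ℂ.*-cong
      (invariant-≈ F-inv (solve 2 (λ u w → ⊝ (u ⊕ w) ⊕ u ⊜ ⊝ w) refl u w))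
      (invariant-≈ F′-inv (sym (assoc v u w))))

    -- For `y ≈ h ∙ x ∙ k`, substituting `k ⁻¹ ∙ w` for `w` moves `k` into `F`, which absorbs it,
    -- while `F′` absorbs `h`.
    ⋆-invariant : DoubleCosetInvariant (F ⋆ F′)
    ⋆-invariant {x} {y} (h , k , h∈H , k∈H , y≈) = ℂ.sym (ℂ.trans
      (∑ᴴ-cong λ w → ℂ.*-congʳ {F′ (y ∙ w)} (invariant-≈ F-inv (sym (identityʳ (w ⁻¹)))))
      (ℂ.trans (∑ᴴ-translate (correlate ε y) (k ⁻¹)) (∑ᴴ-cong λ w → ℂ.*-cong
        (ℂ.sym (F-inv (ε , k , ε-closed , k∈H , solve 2 (λ w k → ⊝ (⊝ k ⊕ w) ⊕ e ⊜ e ⊕ ⊝ w ⊕ k) refl w k)))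
        (ℂ.sym (F′-inv (h , ε , h∈H , ε-closed
          , trans (∙-congʳ y≈) (solve 4 (λ h x k w → h ⊕ x ⊕ k ⊕ (⊝ k ⊕ w) ⊜ h ⊕ (x ⊕ w) ⊕ e) refl h x k w)))))))

    ⊠-represented : ∀ {M N} → Represents F M → Represents F′ N → Represents (F ⋆ F′) (M ⊠ N)
    ⊠-represented {M} {N} M≈ N≈ i j {k} {l} {x} xl≈k = ℂ.trans
      -- The Γ-coordinate `y ⁻¹ ∙ k` of the middle point fits both factors: `y` carries it to `k`,
      -- and `y ⁻¹ ∙ x` carries `l` to it.
      (sum-cong-≋ λ m → ∑-cong λ y → ℂ.*-cong (M≈ i m (Γ.\\-leftDividesˡ y k)) (N≈ m j (factor y)))
      (ℂ.trans (∑-points (correlate (point (i , k)) (point (j , l) ⁻¹)) k) (⋆-translate _ _))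
      where
      factor : ∀ y → y Γ.⁻¹ Γ.∙ x Γ.∙ l Γ.≈ y Γ.⁻¹ Γ.∙ k
      factor y = Γ.trans (Γ.assoc (y Γ.⁻¹) x l) (Γ.∙-congˡ xl≈k)

  -- The roux axioms and the isomorphism of schemes.

  isRoux : IsRoux B
  isRoux = record
    { R1 = proj₁ entries
    ; R2 = λ {i} {j} i≢j → β i j , proj₂ entries i≢j
    ; R3 = B-inverse
    ; R4 = λ {M} {N} M∈ N∈ →
        let F , F-inv , M≈ = inSpan⇒represented {M} M∈
            F′ , F′-inv , N≈ = inSpan⇒represented {N} N∈
        in represented⇒inSpan {F ⋆ F′} {M ⊠ N} (⋆-invariant F-inv F′-inv) (⊠-represented F-inv F′-inv {M} {N} M≈ N≈)
    }

  roux : Roux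
  roux = record { Γ = Γ ; finite = finiteᴳ ; size = n ; B = B ; isRoux = isRoux }

  scheme-≅ : schurianScheme G finite H H? ≅ rouxScheme roux
  scheme-≅ = record
    { bijection = σ
    -- Elements of one double coset index the same matrix, so any `c` whose representative lies in
    -- the double coset of `a` serves.
    ; onto-⊆ = λ a → let c , ca = class-of a in c , matches c a ca
    ; onto-⊇ = λ { (inj₁ g) → proj₁ g , matches (inj₁ g) _ (doubleCoset-refl _)
                 ; (inj₂ g) → proj₁ g ∙ b , matches (inj₂ g) _ (doubleCoset-refl _) }
    }
    where
    open MatrixFamily
    matches : ∀ c a → doubleCoset H (representative c) a → ∀ x y →
              Func.to (adjacency (schurianScheme G finite H H?) a) (x , y) ℂ.≈
              Func.to (adjacency (rouxScheme roux) c) (Inverse.to σ x , Inverse.to σ y)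
    matches c a ca x y = ℂ.trans
      (indicator-⇔ (doubleCosetᴴ? a (y ⁻¹ ∙ x)) (Colour? c (Inverse.to σ x) (Inverse.to σ y)) (mk⇔
        (λ p → Equivalence.to colour (doubleCoset-resp (sym y⁻¹x≈) (doubleCoset-trans ca p)))
        (λ q → doubleCoset-trans (doubleCoset-sym ca) (doubleCoset-resp y⁻¹x≈ (Equivalence.from colour q)))))
      (ℂ.sym (adjacency-matches c))
      where
      colour = doubleCoset⇔Colour c (Inverse.to σ x) (Inverse.to σ y)
      y⁻¹x≈ : point (Inverse.to σ y) ⁻¹ ∙ point (Inverse.to σ x) ≈ y ⁻¹ ∙ x
      y⁻¹x≈ = solve 4 (λ r r′ x y → ⊝ (r′ ⊕ (⊝ r′ ⊕ y)) ⊕ (r ⊕ (⊝ r ⊕ x)) ⊜ ⊝ y ⊕ x)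
        refl (r (cosetK.to x)) (r (cosetK.to y)) x y
      adjacency-matches : ∀ c → Func.to (adjacency (rouxScheme roux) c) (Inverse.to σ x , Inverse.to σ y) ℂ.≈
                          indicator (Colour? c (Inverse.to σ x) (Inverse.to σ y))
      adjacency-matches (inj₁ g) = adjacency-entry (inj₁ g) (Inverse.to σ x) (Inverse.to σ y)
      adjacency-matches (inj₂ g) = adjacency-entry (inj₂ g) (Inverse.to σ x) (Inverse.to σ y)

-- The colouring of an arbitrary roux, and the equivalence.

module RouxColouring (R : Roux) where
  open Roux R
  open GroupRing Γ finite
  open RouxEntries Γ finite
  open IsRoux isRoux
  module Γ = AbelianGroup Γ

  β : Fin size → Fin size → Γ.Carrier
  β i j with i Fin.≟ j
  ... | yes _  = Γ.ε
  ... | no i≢j = proj₁ (R2 i≢j)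

  entries : HasEntries B β
  entries = R1 , off-diagonal
    where
    off-diagonal : ∀ {i j} → i ≢ j → B i j ≋ ⟨ β i j ⟩
    off-diagonal {i} {j} i≢j with i Fin.≟ j
    ... | yes i≡j = contradiction i≡j i≢j
    ... | no i≢j′ = proj₂ (R2 i≢j′)

  -- R3 compares elements of the group ring; `⟨⟩-injective` brings it down to Γ.
  β-sym : ∀ {i j} → i ≢ j → β j i Γ.≈ β i j Γ.⁻¹
  β-sym i≢j = ⟨⟩-injective λ x → ℂ.trans
    (ℂ.sym (proj₂ entries (i≢j ∘ ≡.sym) x)) (R3 i≢j (proj₂ entries i≢j) x)

  open Entries {B = B} β entries public

  adjacency-colour : ∀ c p q →
    Func.to (MatrixFamily.adjacency (rouxScheme R) c) (p , q) ℂ.≈ indicator (Colour? c p q)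
  adjacency-colour (inj₁ g) = adjacency-entry (inj₁ g)
  adjacency-colour (inj₂ g) = adjacency-entry (inj₂ g)

theorem2p1 : (G : Group 0ℓ 0ℓ) (finite : Finite (Group.setoid G)) (H : Subgroup G) (H? : Decidable (Subgroup.Member H)) →
    (∃ λ (R : Roux) → Roux.size R ≢ 2 × schurianScheme G finite H H? ≅ rouxScheme R) ⇔ HigmanPair G H
theorem2p1 G finite H H? = mk⇔ forward backward
  where
  open Group G using (_∙_; _⁻¹)

  forward : (∃ λ (R : Roux) → Roux.size R ≢ 2 × schurianScheme G finite H H? ≅ rouxScheme R) → HigmanPair G H
  forward (R , size≢2 , iso) = HigmanFromColouring.higmanPair H (Roux.Γ R) size≢2 β β-sym bijection
    -- The entries on both sides are indicators, so the equality of matrices says that a double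
    -- coset relation and a colour class agree.
    λ c → let a , a↦c = onto-⊇ c in a , λ x y → indicator-reflects
      (doubleCoset? G finite H H? a (y ⁻¹ ∙ x)) (Colour? c (Inverse.to bijection x) (Inverse.to bijection y))
      (ℂ.trans (a↦c x y) (adjacency-colour c (Inverse.to bijection x) (Inverse.to bijection y)))
    where
    open RouxColouring R
    open _≅_ iso

  backward : HigmanPair G H → ∃ λ (R : Roux) → Roux.size R ≢ 2 × schurianScheme G finite H H? ≅ rouxScheme R
  backward higman = roux , n≢2 , scheme-≅
    where
    open HigmanFiniteness finite H? higman
    open RouxFromHigman finite H? higman K? finiteᴷ finiteᴳ
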